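{- Let $q\in\mathbb{C}$ with $|q|<1$, let $n$ be a non-negative integer, and let $b,x,y\in\mathbb{C}$ with $|xy|<1$ and $|by|<1$. Then \[ \sum_{m=0}^{\infty}\Phi_{m}^{(q^n)}(b,x|q)\frac{y^m}{(q;q)_{m}}=\frac{(q^{n}by;q)_{\infty}}{(xy;q)_{\infty}(by;q)_{\infty}}. \]
   Context: For $a\in\mathbb{C}$ and integers $n\ge 0$, $(a;q)_n=\prod_{k=0}^{n-1}(1-q^k a)$ and $(a;q)_\infty=\prod_{k=0}^{\infty}(1-aq^k)$. The $q$-binomial coefficient is $\genfrac{[}{]}{0pt}{}{m}{k}_q=\frac{(q;q)_m}{(q;q)_k(q;q)_{m-k}}$. The homogeneous Hahn polynomials are $\Phi_{m}^{(\alpha)}(x,y|q)=\sum_{k=0}^{m}\genfrac{[}{]}{0pt}{}{m}{k}_{q}(\alpha;q)_{k}x^ky^{m-k}$; thus $\Phi_{m}^{(q^n)}(b,x|q)=\sum_{k=0}^{m}\genfrac{[}{]}{0pt}{}{m}{k}_{q}(q^n;q)_{k}b^kx^{m-k}$. -}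

module Defs where

open import Data.Nat as ℕ using (ℕ; zero; suc; _∸_)
import Data.Nat.Properties as ℕₚ
import Data.Nat.DivMod as ℕ
open import Data.Integer as ℤ using (+_; -[1+_]; +[1+_]; +0)
import Data.Integer.Properties as ℤₚ
open import Data.Rational as ℚ
  using (ℚ; mkℚ; 0ℚ; 1ℚ; ½; _+_; _*_; _-_; -_; ∣_∣; _<_; _≤_; _⊔_; *<*)
import Data.Rational.Properties as ℚₚ
open import Data.Rational.Solver using (module +-*-Solver)
open import Data.Rational.Unnormalised as ℚᵘ using (mkℚᵘ)
import Data.Rational.Unnormalised.Properties as ℚᵘₚ
open import Data.Product using (∃; _,_; _×_)
open import Data.Sum using (inj₁; inj₂)
open import Relation.Nullary using (yes; no)
open import Relation.Binary.PropositionalEquality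

module RationalLemmas where
  half : ∀ {ε} → 0ℚ < ε → 0ℚ < ½ * ε
  half {ε} ε>0 = subst (_< ½ * ε) (ℚₚ.*-zeroʳ ½) (ℚₚ.*-monoʳ-<-pos ½ ε>0)

  halves : ∀ ε → ½ * ε + ½ * ε ≡ ε
  halves ε = trans (sym (ℚₚ.*-distribʳ-+ ε ½ ½)) (ℚₚ.*-identityˡ ε)

  *-pos : ∀ {p q} → 0ℚ < p → 0ℚ < q → 0ℚ < p * q
  *-pos {p} {q} p>0 q>0 = ℚₚ.positive⁻¹ (p * q)
    {{ℚₚ.pos*pos⇒pos p {{ℚ.positive p>0}} q {{ℚ.positive q>0}}}}

  inv : ∀ {p} → 0ℚ < p → ℚ
  inv {p} p>0 = ℚ.1/_ p {{ℚ.>-nonZero p>0}}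

  inv-pos : ∀ {p} (p>0 : 0ℚ < p) → 0ℚ < inv p>0
  inv-pos {p} p>0 = ℚₚ.positive⁻¹ _ {{ℚₚ.1/pos⇒pos p {{ℚ.positive p>0}}}}

  *-inv : ∀ {p} (p>0 : 0ℚ < p) → p * inv p>0 ≡ 1ℚ
  *-inv {p} p>0 = ℚₚ.*-inverseʳ p {{ℚ.>-nonZero p>0}}

  *-mono-≤ : ∀ {a b c d} → 0ℚ ≤ a → 0ℚ ≤ c → a ≤ b → c ≤ d → a * c ≤ b * d
  *-mono-≤ {a} {b} {c} {d} 0≤a 0≤c a≤b c≤d = ℚₚ.≤-trans
    (ℚₚ.*-monoʳ-≤-nonNeg c {{ℚ.nonNegative 0≤c}} a≤b)
    (ℚₚ.*-monoˡ-≤-nonNeg b {{ℚ.nonNegative (ℚₚ.≤-trans 0≤a a≤b)}} c≤d)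

  0≤∣_∣ : ∀ p → 0ℚ ≤ ∣ p ∣
  0≤∣ p ∣ = ℚₚ.nonNegative⁻¹ ∣ p ∣ {{ℚₚ.∣-∣-nonNeg p}}

  0<1 : 0ℚ < 1ℚ
  0<1 = ℚₚ.positive⁻¹ 1ℚ

  p≤∣p∣ : ∀ p → p ≤ ∣ p ∣
  p≤∣p∣ p with ℚₚ.≤-total 0ℚ p
  ... | inj₁ 0≤p = ℚₚ.≤-reflexive (sym (ℚₚ.0≤p⇒∣p∣≡p 0≤p))
  ... | inj₂ p≤0 = ℚₚ.≤-trans p≤0 0≤∣ p ∣

  ∣p-q∣≡∣q-p∣ : ∀ p q → ∣ p - q ∣ ≡ ∣ q - p ∣
  ∣p-q∣≡∣q-p∣ p q = trans (cong ∣_∣ (solve 2 (λ p q → p :- q := :- (q :- p)) refl p q))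
                          (ℚₚ.∣-p∣≡∣p∣ (q - p))
    where open +-*-Solver

  ∣p+q∣<ε : ∀ {p q ε} → ∣ p ∣ < ½ * ε → ∣ q ∣ < ½ * ε → ∣ p + q ∣ < ε
  ∣p+q∣<ε {p} {q} {ε} hp hq = subst (∣ p + q ∣ <_) (halves ε)
    (ℚₚ.≤-<-trans (ℚₚ.∣p+q∣≤∣p∣+∣q∣ p q) (ℚₚ.+-mono-< hp hq))

  ∣p*q∣<B*δ : ∀ {p q B δ} → 0ℚ < B → ∣ p ∣ ≤ B → ∣ q ∣ < δ → ∣ p * q ∣ < B * δ
  ∣p*q∣<B*δ {p} {q} {B} {δ} B>0 hp hq = subst (_< B * δ) (sym (ℚₚ.∣p*q∣≡∣p∣*∣q∣ p q))
    (ℚₚ.≤-<-trans (ℚₚ.*-monoʳ-≤-nonNeg ∣ q ∣ {{ℚₚ.∣-∣-nonNeg q}} hp)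
                  (ℚₚ.*-monoʳ-<-pos B {{ℚ.positive B>0}} hq))

  *-inv-cancel : ∀ {B} (B>0 : 0ℚ < B) ε → B * (inv B>0 * ε) ≡ ε
  *-inv-cancel {B} B>0 ε = trans (sym (ℚₚ.*-assoc B (inv B>0) ε))
    (trans (cong (_* ε) (*-inv B>0)) (ℚₚ.*-identityˡ ε))

open RationalLemmas

-- Reals are Cauchy sequences of rationals; sequences whose difference tends to 0
-- represent the same real.

Cauchy : (ℕ → ℚ) → Set
Cauchy x = ∀ ε → 0ℚ < ε →
  ∃ λ N → ∀ m n → N ℕ.≤ m → N ℕ.≤ n → ∣ x m - x n ∣ < ε

record ℝ : Set where
  no-eta-equality
  constructor mkℝ
  field
    seq    : ℕ → ℚ
    cauchy : Cauchy seq

open ℝ public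

infix 4 _<ᴿ_

record _<ᴿ_ (x y : ℝ) : Set where
  constructor mk<
  field
    gap     : ℚ
    gap>0   : 0ℚ < gap
    from    : ℕ
    gap-ok  : ∀ n → from ℕ.≤ n → seq x n + gap ≤ seq y n

constᴿ : ℚ → ℝ
seq    (constᴿ p) _ = p
cauchy (constᴿ p) ε ε>0 =
  0 , λ _ _ _ _ → subst (_< ε) (sym (cong ∣_∣ (ℚₚ.+-inverseʳ p))) ε>0

0ᴿ 1ᴿ : ℝ
0ᴿ = constᴿ 0ℚ
1ᴿ = constᴿ 1ℚ

module RealBounds where
  bounded : (x : ℝ) → ∃ λ B → 0ℚ < B × ∃ λ N → ∀ n → N ℕ.≤ n → ∣ seq x n ∣ ≤ B
  bounded x with cauchy x 1ℚ 0<1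
  ... | N , close = 1ℚ + ∣ seq x N ∣ , ℚₚ.+-mono-<-≤ 0<1 0≤∣ seq x N ∣ , N , bound
    where
    open ℚₚ.≤-Reasoning
    open +-*-Solver
    bound : ∀ n → N ℕ.≤ n → ∣ seq x n ∣ ≤ 1ℚ + ∣ seq x N ∣
    bound n N≤n = begin
      ∣ seq x n ∣
        ≡⟨ cong ∣_∣ (solve 2 (λ a b → a := (a :- b) :+ b) refl (seq x n) (seq x N)) ⟩
      ∣ (seq x n - seq x N) + seq x N ∣
        ≤⟨ ℚₚ.∣p+q∣≤∣p∣+∣q∣ (seq x n - seq x N) (seq x N) ⟩
      ∣ seq x n - seq x N ∣ + ∣ seq x N ∣
        ≤⟨ ℚₚ.+-monoˡ-≤ ∣ seq x N ∣ (ℚₚ.<⇒≤ (close n N N≤n ℕₚ.≤-refl)) ⟩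
      1ℚ + ∣ seq x N ∣ ∎

open RealBounds

infix  8 -ᴿ_
infixl 7 _*ᴿ_
infixl 6 _+ᴿ_

-ᴿ_ : ℝ → ℝ
seq    (-ᴿ x) n = - seq x n
cauchy (-ᴿ x) ε ε>0 =
  let N , close = cauchy x ε ε>0 in
  N , λ m n N≤m N≤n →
    subst (_< ε)
      (trans (∣p-q∣≡∣q-p∣ (seq x m) (seq x n)) (cong ∣_∣
        (solve 2 (λ a b → b :- a := :- a :- (:- b)) refl (seq x m) (seq x n))))
      (close m n N≤m N≤n)
  where open +-*-Solver

_+ᴿ_ : ℝ → ℝ → ℝ
seq    (x +ᴿ y) n = seq x n + seq y n
cauchy (x +ᴿ y) ε ε>0 =
  let N₁ , close₁ = cauchy x (½ * ε) (half ε>0)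
      N₂ , close₂ = cauchy y (½ * ε) (half ε>0)
  in N₁ ℕ.⊔ N₂ , λ m n N≤m N≤n →
    subst (_< ε)
      (cong ∣_∣ (solve 4 (λ a b c d → (a :- b) :+ (c :- d) := (a :+ c) :- (b :+ d))
        refl (seq x m) (seq x n) (seq y m) (seq y n)))
      (∣p+q∣<ε {seq x m - seq x n} {seq y m - seq y n}
        (close₁ m n (ℕₚ.m⊔n≤o⇒m≤o N₁ N₂ N≤m) (ℕₚ.m⊔n≤o⇒m≤o N₁ N₂ N≤n))
        (close₂ m n (ℕₚ.m⊔n≤o⇒n≤o N₁ N₂ N≤m) (ℕₚ.m⊔n≤o⇒n≤o N₁ N₂ N≤n)))
  where open +-*-Solver

_*ᴿ_ : ℝ → ℝ → ℝ
seq    (x *ᴿ y) n = seq x n * seq y n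
cauchy (x *ᴿ y) ε ε>0 =
  let A , A>0 , M₁ , boundˣ = bounded x
      B , B>0 , M₂ , boundʸ = bounded y
      N₁ , close₁ = cauchy x (inv B>0 * (½ * ε)) (*-pos (inv-pos B>0) (half ε>0))
      N₂ , close₂ = cauchy y (inv A>0 * (½ * ε)) (*-pos (inv-pos A>0) (half ε>0))
      M = M₁ ℕ.⊔ M₂
      N = N₁ ℕ.⊔ N₂
  in M ℕ.⊔ N , λ m n ≤m ≤n →
    let M≤m = ℕₚ.m⊔n≤o⇒m≤o M N ≤m
        N≤m = ℕₚ.m⊔n≤o⇒n≤o M N ≤m
        M≤n = ℕₚ.m⊔n≤o⇒m≤o M N ≤n
        N≤n = ℕₚ.m⊔n≤o⇒n≤o M N ≤n
    in subst (_< ε)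
      (cong ∣_∣ (solve 4 (λ a b c d → a :* (c :- d) :+ d :* (a :- b) := a :* c :- b :* d)
        refl (seq x m) (seq x n) (seq y m) (seq y n)))
      (∣p+q∣<ε {seq x m * (seq y m - seq y n)} {seq y n * (seq x m - seq x n)}
        (subst (∣ seq x m * (seq y m - seq y n) ∣ <_) (*-inv-cancel A>0 (½ * ε))
          (∣p*q∣<B*δ A>0 (boundˣ m (ℕₚ.m⊔n≤o⇒m≤o M₁ M₂ M≤m))
            (close₂ m n (ℕₚ.m⊔n≤o⇒n≤o N₁ N₂ N≤m) (ℕₚ.m⊔n≤o⇒n≤o N₁ N₂ N≤n))))
        (subst (∣ seq y n * (seq x m - seq x n) ∣ <_) (*-inv-cancel B>0 (½ * ε))
          (∣p*q∣<B*δ B>0 (boundʸ n (ℕₚ.m⊔n≤o⇒n≤o M₁ M₂ M≤n))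
            (close₁ m n (ℕₚ.m⊔n≤o⇒m≤o N₁ N₂ N≤m) (ℕₚ.m⊔n≤o⇒m≤o N₁ N₂ N≤n)))))
  where open +-*-Solver

module Inverse (x : ℝ) (x>0 : 0ᴿ <ᴿ x) where
  open _<ᴿ_ x>0 renaming (gap to δ; gap>0 to δ>0; from to N₀; gap-ok to above)
  open +-*-Solver

  pos : ∀ n → 0ℚ < seq x n ⊔ δ
  pos n = ℚₚ.<-≤-trans δ>0 (ℚₚ.p≤q⊔p (seq x n) δ)

  B = inv δ>0 * inv δ>0
  B>0 : 0ℚ < B
  B>0 = *-pos (inv-pos δ>0) (inv-pos δ>0)

  unchanged : ∀ n → N₀ ℕ.≤ n → seq x n ⊔ δ ≡ seq x n
  unchanged n N₀≤n = ℚₚ.p≥q⇒p⊔q≡p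
    (subst (_≤ seq x n) (ℚₚ.+-identityˡ δ) (above n N₀≤n))

  inv-≤ : ∀ n → inv (pos n) ≤ inv δ>0
  inv-≤ n = subst₂ _≤_ (*-inv-cancel δ>0 (inv (pos n)))
    (trans (solve 3 (λ a d g → a :* (d :* g) := d :* (a :* g)) refl
             (seq x n ⊔ δ) (inv δ>0) (inv (pos n)))
      (trans (cong (inv δ>0 *_) (*-inv (pos n))) (ℚₚ.*-identityʳ (inv δ>0))))
    (ℚₚ.*-monoʳ-≤-nonNeg (inv δ>0 * inv (pos n))
      {{ℚ.nonNegative (ℚₚ.<⇒≤ (*-pos (inv-pos δ>0) (inv-pos (pos n))))}}
      (ℚₚ.p≤q⊔p (seq x n) δ))

  bound : ∀ m n → ∣ inv (pos m) * inv (pos n) ∣ ≤ B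
  bound m n = subst (_≤ B)
    (sym (ℚₚ.0≤p⇒∣p∣≡p (ℚₚ.<⇒≤ (*-pos (inv-pos (pos m)) (inv-pos (pos n))))))
    (*-mono-≤ (ℚₚ.<⇒≤ (inv-pos (pos m))) (ℚₚ.<⇒≤ (inv-pos (pos n))) (inv-≤ m) (inv-≤ n))

  difference : ∀ m n → inv (pos m) - inv (pos n)
    ≡ (inv (pos m) * inv (pos n)) * ((seq x n ⊔ δ) - (seq x m ⊔ δ))
  difference m n = begin
    g - h                     ≡⟨ cong₂ _-_ (sym (ℚₚ.*-identityʳ g)) (sym (ℚₚ.*-identityʳ h)) ⟩
    g * 1ℚ - h * 1ℚ           ≡⟨ cong₂ (λ u v → g * u - h * v)
                                   (sym (*-inv (pos n))) (sym (*-inv (pos m))) ⟩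
    g * (b * h) - h * (a * g) ≡⟨ solve 4 (λ a b g h → g :* (b :* h) :- h :* (a :* g)
                                   := (g :* h) :* (b :- a)) refl a b g h ⟩
    (g * h) * (b - a)         ∎
    where
    open ≡-Reasoning
    a = seq x m ⊔ δ
    b = seq x n ⊔ δ
    g = inv (pos m)
    h = inv (pos n)

  inv-cauchy : Cauchy (λ n → inv (pos n))
  inv-cauchy ε ε>0 =
    let N , close = cauchy x (inv B>0 * ε) (*-pos (inv-pos B>0) ε>0)
    in N₀ ℕ.⊔ N , λ m n ≤m ≤n →
      subst (_< ε) (sym (cong ∣_∣ (difference m n)))
        (subst (∣ (inv (pos m) * inv (pos n)) * ((seq x n ⊔ δ) - (seq x m ⊔ δ)) ∣ <_)
          (*-inv-cancel B>0 ε)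
          (∣p*q∣<B*δ B>0 (bound m n)
            (subst₂ (λ a b → ∣ a - b ∣ < inv B>0 * ε)
              (sym (unchanged n (ℕₚ.m⊔n≤o⇒m≤o N₀ N ≤n)))
              (sym (unchanged m (ℕₚ.m⊔n≤o⇒m≤o N₀ N ≤m)))
              (close n m (ℕₚ.m⊔n≤o⇒n≤o N₀ N ≤n) (ℕₚ.m⊔n≤o⇒n≤o N₀ N ≤m)))))

-- The terms of x are eventually at least δ; taking the maximum with δ changes
-- none of those and makes every term invertible.
invᴿ : (x : ℝ) → 0ᴿ <ᴿ x → ℝ
seq    (invᴿ x x>0) n = inv (Inverse.pos x x>0 n)
cauchy (invᴿ x x>0)   = Inverse.inv-cauchy x x>0

⌊√_⌋ : ℕ → ℕ
⌊√ zero ⌋ = 0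
⌊√ suc n ⌋ with suc ⌊√ n ⌋ ℕ.* suc ⌊√ n ⌋ ℕ.≤? suc n
... | yes _ = suc ⌊√ n ⌋
... | no  _ = ⌊√ n ⌋

-- The largest multiple of 1/(n+1) whose square is at most ∣r∣: for ∣r∣ = p/d,
-- (k/(n+1))² ≤ p/d amounts to k² ≤ ⌊p(n+1)²/d⌋.
approx√ : ℕ → ℚ → ℚ
approx√ n r =
  + ⌊√ (ℤ.∣ ℚ.↥ r ∣ ℕ.* (suc n ℕ.* suc n)) ℕ./ ℚ.↧ₙ r ⌋ ℚ./ suc n

module RootLemmas where
  ⌊√⌋-lower : ∀ n → ⌊√ n ⌋ ℕ.* ⌊√ n ⌋ ℕ.≤ n
  ⌊√⌋-lower zero = ℕ.z≤n
  ⌊√⌋-lower (suc n) with suc ⌊√ n ⌋ ℕ.* suc ⌊√ n ⌋ ℕ.≤? suc n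
  ... | yes le = le
  ... | no  _  = ℕₚ.m≤n⇒m≤1+n (⌊√⌋-lower n)

  ⌊√⌋-upper : ∀ n → n ℕ.< suc ⌊√ n ⌋ ℕ.* suc ⌊√ n ⌋
  ⌊√⌋-upper zero = ℕ.s≤s ℕ.z≤n
  ⌊√⌋-upper (suc n) with suc ⌊√ n ⌋ ℕ.* suc ⌊√ n ⌋ ℕ.≤? suc n
  ... | yes _ = ℕₚ.≤-<-trans (⌊√⌋-upper n)
                  (ℕₚ.*-mono-< (ℕₚ.n<1+n (suc ⌊√ n ⌋)) (ℕₚ.n<1+n (suc ⌊√ n ⌋)))
  ... | no gt = ℕₚ.≰⇒> gt

  ι : ℕ → ℚ
  ι k = + k ℚ./ 1

  ιᵘ : ∀ k → ℚ.toℚᵘ (ι k) ℚᵘ.≃ mkℚᵘ (+ k) 0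
  ιᵘ k = ℚₚ.toℚᵘ-fromℚᵘ (mkℚᵘ (+ k) 0)

  ι-* : ∀ a b → ι (a ℕ.* b) ≡ ι a * ι b
  ι-* a b = ℚₚ.toℚᵘ-injective (begin
    ℚ.toℚᵘ (ι (a ℕ.* b))               ≈⟨ ιᵘ (a ℕ.* b) ⟩
    mkℚᵘ (+ (a ℕ.* b)) 0               ≈⟨ ℚᵘ.*≡* (cong (ℤ._* + 1) (ℤₚ.pos-* a b)) ⟩
    mkℚᵘ (+ a) 0 ℚᵘ.* mkℚᵘ (+ b) 0     ≈⟨ ℚᵘₚ.*-cong (ιᵘ a) (ιᵘ b) ⟨
    ℚ.toℚᵘ (ι a) ℚᵘ.* ℚ.toℚᵘ (ι b)     ≈⟨ ℚₚ.toℚᵘ-homo-* (ι a) (ι b) ⟨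
    ℚ.toℚᵘ (ι a * ι b)                 ∎)
    where open ℚᵘₚ.≃-Reasoning

  ι-suc : ∀ k → ι (suc k) ≡ ι k + 1ℚ
  ι-suc k = ℚₚ.toℚᵘ-injective (begin
    ℚ.toℚᵘ (ι (suc k))                 ≈⟨ ιᵘ (suc k) ⟩
    mkℚᵘ (+ suc k) 0                   ≈⟨ ℚᵘ.*≡* (cong (ℤ._* + 1) lem) ⟩
    mkℚᵘ (+ k) 0 ℚᵘ.+ mkℚᵘ (+ 1) 0     ≈⟨ ℚᵘₚ.+-cong (ιᵘ k) ℚᵘₚ.≃-refl ⟨
    ℚ.toℚᵘ (ι k) ℚᵘ.+ ℚ.toℚᵘ 1ℚ        ≈⟨ ℚₚ.toℚᵘ-homo-+ (ι k) 1ℚ ⟨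
    ℚ.toℚᵘ (ι k + 1ℚ)                  ∎)
    where
    open ℚᵘₚ.≃-Reasoning
    lem : + suc k ≡ + k ℤ.* + 1 ℤ.+ + 1 ℤ.* + 1
    lem = trans (cong +_ (ℕₚ.+-comm 1 k)) (cong (ℤ._+ + 1) (sym (ℤₚ.*-identityʳ (+ k))))

  ι-mono-≤ : ∀ {a b} → a ℕ.≤ b → ι a ≤ ι b
  ι-mono-≤ {a} {b} a≤b = ℚₚ.toℚᵘ-cancel-≤
    (ℚᵘₚ.≤-respˡ-≃ (ℚᵘₚ.≃-sym (ιᵘ a)) (ℚᵘₚ.≤-respʳ-≃ (ℚᵘₚ.≃-sym (ιᵘ b))
      (ℚᵘ.*≤* (ℤₚ.*-monoʳ-≤-nonNeg (+ 1) (ℤ.+≤+ a≤b)))))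

  ι-mono-< : ∀ {a b} → a ℕ.< b → ι a < ι b
  ι-mono-< {a} {b} a<b = ℚₚ.toℚᵘ-cancel-<
    (ℚᵘₚ.<-respˡ-≃ (ℚᵘₚ.≃-sym (ιᵘ a)) (ℚᵘₚ.<-respʳ-≃ (ℚᵘₚ.≃-sym (ιᵘ b))
      (ℚᵘ.*<* (ℤₚ.*-monoʳ-<-pos (+ 1) (ℤ.+<+ a<b)))))

  /-*-ι : ∀ k n → (+ k ℚ./ suc n) * ι (suc n) ≡ ι k
  /-*-ι k n = ℚₚ.toℚᵘ-injective (begin
    ℚ.toℚᵘ ((+ k ℚ./ suc n) * ι (suc n))
      ≈⟨ ℚₚ.toℚᵘ-homo-* (+ k ℚ./ suc n) (ι (suc n)) ⟩
    ℚ.toℚᵘ (+ k ℚ./ suc n) ℚᵘ.* ℚ.toℚᵘ (ι (suc n))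
      ≈⟨ ℚᵘₚ.*-cong (ℚₚ.toℚᵘ-fromℚᵘ (mkℚᵘ (+ k) n)) (ιᵘ (suc n)) ⟩
    mkℚᵘ (+ k) n ℚᵘ.* mkℚᵘ (+ suc n) 0
      ≈⟨ ℚᵘ.*≡* (trans (ℤₚ.*-identityʳ (+ k ℤ.* + suc n))
                  (cong (λ d → + k ℤ.* + d) (sym (ℕₚ.*-identityʳ (suc n))))) ⟩
    mkℚᵘ (+ k) 0
      ≈⟨ ιᵘ k ⟨
    ℚ.toℚᵘ (ι k) ∎)
    where open ℚᵘₚ.≃-Reasoning

  ∣∣-*-ι : ∀ r → ∣ r ∣ * ι (ℚ.↧ₙ r) ≡ ι ℤ.∣ ℚ.↥ r ∣
  ∣∣-*-ι r@(mkℚ i d _) = subst (λ s → s * ι (suc d) ≡ ι ℤ.∣ i ∣)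
    (ℚₚ.fromℚᵘ-toℚᵘ ∣ r ∣) (/-*-ι ℤ.∣ i ∣ d)

  ι-suc>0 : ∀ n → 0ℚ < ι (suc n)
  ι-suc>0 n = ι-mono-< {0} {suc n} (ℕ.s≤s ℕ.z≤n)

  module Approx (n : ℕ) (r : ℚ) where
    p = ℤ.∣ ℚ.↥ r ∣
    d = ℚ.↧ₙ r
    N = suc n
    P = p ℕ.* (N ℕ.* N)
    k = ⌊√ P ℕ./ d ⌋
    s = approx√ n r
    h = + 1 ℚ./ N
    scale = ι d * (ι N * ι N)

    scale>0 : 0ℚ < scale
    scale>0 = *-pos (ι-suc>0 (ℚ.ℚ.denominator-1 r)) (*-pos (ι-suc>0 n) (ι-suc>0 n))

    rhs : ι P ≡ ∣ r ∣ * scale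
    rhs = begin
      ι P                      ≡⟨ trans (ι-* p (N ℕ.* N)) (cong (ι p *_) (ι-* N N)) ⟩
      ι p * (ι N * ι N)        ≡⟨ cong (_* (ι N * ι N)) (∣∣-*-ι r) ⟨
      ∣ r ∣ * ι d * (ι N * ι N) ≡⟨ ℚₚ.*-assoc ∣ r ∣ (ι d) (ι N * ι N) ⟩
      ∣ r ∣ * scale            ∎
      where open ≡-Reasoning

    lhs : ∀ j t → t * ι N ≡ ι j → ι (j ℕ.* j ℕ.* d) ≡ t * t * scale
    lhs j t eq = begin
      ι (j ℕ.* j ℕ.* d)        ≡⟨ trans (ι-* (j ℕ.* j) d) (cong (_* ι d) (ι-* j j)) ⟩
      ι j * ι j * ι d          ≡⟨ cong (λ u → u * u * ι d) eq ⟨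
      (t * ι N) * (t * ι N) * ι d
        ≡⟨ solve 3 (λ t N d → (t :* N) :* (t :* N) :* d := t :* t :* (d :* (N :* N)))
             refl t (ι N) (ι d) ⟩
      t * t * scale            ∎
      where open ≡-Reasoning
            open +-*-Solver

    lower : s * s ≤ ∣ r ∣
    lower = ℚₚ.*-cancelʳ-≤-pos scale {{ℚ.positive scale>0}}
      (subst₂ _≤_ (lhs k s (/-*-ι k n)) rhs (ι-mono-≤
        (ℕₚ.≤-trans (ℕₚ.*-monoˡ-≤ d (⌊√⌋-lower (P ℕ./ d))) (ℕ.m/n*n≤m P d))))

    upper : ∣ r ∣ < (s + h) * (s + h)
    upper = ℚₚ.*-cancelʳ-<-nonNeg scale {{ℚ.nonNegative (ℚₚ.<⇒≤ scale>0)}}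
      (subst₂ _<_ rhs (lhs (suc k) (s + h) s+h) (ι-mono-< (ℕₚ.<-≤-trans
        (subst (ℕ._< suc (P ℕ./ d) ℕ.* d) (sym (ℕ.m≡m%n+[m/n]*n P d))
          (ℕₚ.+-monoˡ-< ((P ℕ./ d) ℕ.* d) (ℕ.m%n<n P d)))
        (ℕₚ.*-monoˡ-≤ d (⌊√⌋-upper (P ℕ./ d))))))
      where
      s+h : (s + h) * ι N ≡ ι (suc k)
      s+h = trans (ℚₚ.*-distribʳ-+ (ι N) s h)
        (trans (cong₂ _+_ (/-*-ι k n) (/-*-ι 1 n)) (sym (ι-suc k)))

    s≥0 : 0ℚ ≤ s
    s≥0 = ℚₚ.*-cancelʳ-≤-pos (ι N) {{ℚ.positive (ι-suc>0 n)}}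
      (subst₂ _≤_ (sym (ℚₚ.*-zeroˡ (ι N))) (sym (/-*-ι k n)) (ι-mono-≤ {0} {k} ℕ.z≤n))

    h≥0 : 0ℚ ≤ h
    h≥0 = ℚₚ.*-cancelʳ-≤-pos (ι N) {{ℚ.positive (ι-suc>0 n)}}
      (subst₂ _≤_ (sym (ℚₚ.*-zeroˡ (ι N))) (sym (/-*-ι 1 n)) (ι-mono-≤ {0} {1} ℕ.z≤n))

  archimedean : ∀ ε → 0ℚ < ε → ∃ λ N → ∀ n → N ℕ.≤ n → + 1 ℚ./ suc n < ε
  archimedean (mkℚ +0 _ _) (*<* (ℤ.+<+ ()))
  archimedean (mkℚ -[1+ _ ] _ _) (*<* ())
  archimedean (mkℚ +[1+ a ] d c) _ = suc d , λ n d<n →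
    ℚₚ.toℚᵘ-cancel-<
      (ℚᵘₚ.<-respˡ-≃ (ℚᵘₚ.≃-sym (ℚₚ.toℚᵘ-fromℚᵘ (mkℚᵘ (+ 1) n)))
        (ℚᵘ.*<* (subst₂ ℤ._<_ (sym (ℤₚ.*-identityˡ (+ suc d))) (ℤₚ.pos-* (suc a) (suc n))
          (ℤ.+<+ (ℕₚ.<-≤-trans (ℕ.s≤s d<n) (ℕₚ.m≤m+n (suc n) (a ℕ.* suc n)))))))

  approx√-close : ∀ m n r t η → 0ℚ < η → ∣ r - t ∣ < η * η → + 1 ℚ./ suc n < η →
                  approx√ m r - approx√ n t < η + η
  approx√-close m n r t η η>0 r-t<η² h<η = ℚₚ.≰⇒> λ le → ℚₚ.<⇒≢ (impossible le) refl
    where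
    open ℚₚ.≤-Reasoning
    open +-*-Solver
    S = approx√ m r
    T = approx√ n t
    h = + 1 ℚ./ suc n
    u = T + h
    u≥0 : 0ℚ ≤ u
    u≥0 = ℚₚ.+-mono-≤ (Approx.s≥0 n t) (Approx.h≥0 n t)

    u+η≥0 : 0ℚ ≤ u + η
    u+η≥0 = ℚₚ.+-mono-≤ u≥0 (ℚₚ.<⇒≤ η>0)

    u+η≤S : η + η ≤ S - T → u + η ≤ S
    u+η≤S le = begin
      (T + h) + η          ≤⟨ ℚₚ.+-monoˡ-≤ η (ℚₚ.+-monoʳ-≤ T (ℚₚ.<⇒≤ h<η)) ⟩
      (T + η) + η          ≡⟨ ℚₚ.+-assoc T η η ⟩
      T + (η + η)          ≤⟨ ℚₚ.+-monoʳ-≤ T le ⟩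
      T + (S - T)          ≡⟨ solve 2 (λ a b → a :+ (b :- a) := b) refl T S ⟩
      S                    ∎

    impossible : η + η ≤ S - T → u * u + η * η < u * u + η * η
    impossible le = begin-strict
      u * u + η * η
        ≡⟨ ℚₚ.+-identityʳ _ ⟨
      u * u + η * η + 0ℚ
        ≤⟨ ℚₚ.+-monoʳ-≤ (u * u + η * η) (ℚₚ.+-mono-≤ u*η≥0 u*η≥0) ⟩
      u * u + η * η + (u * η + u * η)
        ≡⟨ solve 2 (λ u η → u :* u :+ η :* η :+ (u :* η :+ u :* η)
             := (u :+ η) :* (u :+ η)) refl u η ⟩
      (u + η) * (u + η)
        ≤⟨ *-mono-≤ u+η≥0 u+η≥0 (u+η≤S le) (u+η≤S le) ⟩
      S * S
        ≤⟨ Approx.lower m r ⟩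
      ∣ r ∣
        ≡⟨ cong ∣_∣ (solve 2 (λ r t → r := t :+ (r :- t)) refl r t) ⟩
      ∣ t + (r - t) ∣
        ≤⟨ ℚₚ.∣p+q∣≤∣p∣+∣q∣ t (r - t) ⟩
      ∣ t ∣ + ∣ r - t ∣
        <⟨ ℚₚ.+-mono-< (Approx.upper n t) r-t<η² ⟩
      u * u + η * η ∎
      where
      u*η≥0 : 0ℚ ≤ u * η
      u*η≥0 = subst (_≤ u * η) (ℚₚ.*-zeroˡ η)
        (ℚₚ.*-monoʳ-≤-nonNeg η {{ℚ.nonNegative (ℚₚ.<⇒≤ η>0)}} u≥0)

open RootLemmas

-- On negative reals this is the square root of the absolute value.
√ᴿ : ℝ → ℝ
seq    (√ᴿ x) n = approx√ n (seq x n)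
cauchy (√ᴿ x) ε ε>0 =
  let η = ½ * ε
      η>0 = half ε>0
      N₁ , close = cauchy x (η * η) (*-pos η>0 η>0)
      N₂ , small = archimedean η η>0
      one-sided : ∀ m n → N₁ ℕ.⊔ N₂ ℕ.≤ m → N₁ ℕ.⊔ N₂ ℕ.≤ n →
                  approx√ m (seq x m) - approx√ n (seq x n) < ε
      one-sided m n ≤m ≤n = subst (approx√ m (seq x m) - approx√ n (seq x n) <_) (halves ε)
        (approx√-close m n (seq x m) (seq x n) η η>0
          (close m n (ℕₚ.m⊔n≤o⇒m≤o N₁ N₂ ≤m) (ℕₚ.m⊔n≤o⇒m≤o N₁ N₂ ≤n))
          (small n (ℕₚ.m⊔n≤o⇒n≤o N₁ N₂ ≤n)))
  in N₁ ℕ.⊔ N₂ , λ m n ≤m ≤n →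
    ∣p-q∣<ε (approx√ m (seq x m)) (approx√ n (seq x n)) (one-sided m n ≤m ≤n) (one-sided n m ≤n ≤m)
  where
  open +-*-Solver
  ∣p-q∣<ε : ∀ p q {ε} → p - q < ε → q - p < ε → ∣ p - q ∣ < ε
  ∣p-q∣<ε p q {ε} p-q<ε q-p<ε with ℚₚ.∣p∣≡p∨∣p∣≡-p (p - q)
  ... | inj₁ eq = subst (_< ε) (sym eq) p-q<ε
  ... | inj₂ eq = subst (_< ε)
    (sym (trans eq (solve 2 (λ p q → :- (p :- q) := q :- p) refl p q))) q-p<ε

record ℂ : Set where
  no-eta-equality
  constructor mkℂ
  field
    re im : ℝ

open ℂ public

0ᶜ 1ᶜ : ℂ
re 0ᶜ = 0ᴿ
im 0ᶜ = 0ᴿ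
re 1ᶜ = 1ᴿ
im 1ᶜ = 0ᴿ

infixl 7 _*ᶜ_
infixl 6 _+ᶜ_ _-ᶜ_

_+ᶜ_ _-ᶜ_ _*ᶜ_ : ℂ → ℂ → ℂ
re (z +ᶜ w) = re z +ᴿ re w
im (z +ᶜ w) = im z +ᴿ im w
re (z -ᶜ w) = re z +ᴿ -ᴿ re w
im (z -ᶜ w) = im z +ᴿ -ᴿ im w
re (z *ᶜ w) = re z *ᴿ re w +ᴿ -ᴿ (im z *ᴿ im w)
im (z *ᶜ w) = re z *ᴿ im w +ᴿ im z *ᴿ re w

∣_∣² : ℂ → ℝ
∣ z ∣² = re z *ᴿ re z +ᴿ im z *ᴿ im z

∣_∣ᶜ : ℂ → ℝ
∣ z ∣ᶜ = √ᴿ ∣ z ∣²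

-- z is apart from 0, the constructive form of z ≠ 0.
NonZeroᶜ : ℂ → Set
NonZeroᶜ z = 0ᴿ <ᴿ ∣ z ∣²

invᶜ : (z : ℂ) → NonZeroᶜ z → ℂ
re (invᶜ z z≠0) = re z *ᴿ invᴿ ∣ z ∣² z≠0
im (invᶜ z z≠0) = -ᴿ im z *ᴿ invᴿ ∣ z ∣² z≠0

infixl 7 _/ᶜ_⟨_⟩
_/ᶜ_⟨_⟩ : (z w : ℂ) → NonZeroᶜ w → ℂ
z /ᶜ w ⟨ w≠0 ⟩ = z *ᶜ invᶜ w w≠0

*-nonZeroᶜ : ∀ z w → NonZeroᶜ z → NonZeroᶜ w → NonZeroᶜ (z *ᶜ w)
*-nonZeroᶜ z w (mk< δ δ>0 M above-z) (mk< η η>0 N above-w) =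
  mk< (δ * η) (*-pos δ>0 η>0) (M ℕ.⊔ N) λ n ≤n →
    subst₂ _≤_ (sym (ℚₚ.+-identityˡ (δ * η)))
      (solve 4 (λ a b c d → (a :* a :+ b :* b) :* (c :* c :+ d :* d)
        := (a :* c :+ :- (b :* d)) :* (a :* c :+ :- (b :* d))
             :+ (a :* d :+ b :* c) :* (a :* d :+ b :* c)) refl
        (seq (re z) n) (seq (im z) n) (seq (re w) n) (seq (im w) n))
      (*-mono-≤ (ℚₚ.<⇒≤ δ>0) (ℚₚ.<⇒≤ η>0)
        (subst (_≤ seq ∣ z ∣² n) (ℚₚ.+-identityˡ δ) (above-z n (ℕₚ.m⊔n≤o⇒m≤o M N ≤n)))
        (subst (_≤ seq ∣ w ∣² n) (ℚₚ.+-identityˡ η) (above-w n (ℕₚ.m⊔n≤o⇒n≤o M N ≤n))))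
  where open +-*-Solver

infixr 8 _^ᶜ_
_^ᶜ_ : ℂ → ℕ → ℂ
z ^ᶜ zero  = 1ᶜ
z ^ᶜ suc n = z *ᶜ z ^ᶜ n

-- Sum and product of f 0, …, f (n-1).
Σ< ∏< : ℕ → (ℕ → ℂ) → ℂ
Σ< zero    f = 0ᶜ
Σ< (suc n) f = Σ< n f +ᶜ f n
∏< zero    f = 1ᶜ
∏< (suc n) f = ∏< n f *ᶜ f n

infix 4 _⟶_
_⟶_ : (ℕ → ℂ) → ℂ → Set
s ⟶ ℓ = ∀ ε → 0ᴿ <ᴿ ε → ∃ λ N → ∀ n → N ℕ.≤ n → ∣ s n -ᶜ ℓ ∣ᶜ <ᴿ ε

HasSum HasProduct : (ℕ → ℂ) → ℂ → Set
HasSum     f ℓ = (λ n → Σ< n f) ⟶ ℓ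
HasProduct f ℓ = (λ n → ∏< n f) ⟶ ℓ

qFactor : (a q : ℂ) → ℕ → ℂ
qFactor a q k = 1ᶜ -ᶜ q ^ᶜ k *ᶜ a

qPochhammer : (a q : ℂ) → ℕ → ℂ
qPochhammer a q n = ∏< n (qFactor a q)

IsQPochhammer∞ : (a q P : ℂ) → Set
IsQPochhammer∞ a q P = HasProduct (qFactor a q) P

module _ (q : ℂ) (q≠ : ∀ m → NonZeroᶜ (qPochhammer q q m)) where

  qBinomial : ℕ → ℕ → ℂ
  qBinomial m k =
    qPochhammer q q m /ᶜ (qPochhammer q q k *ᶜ qPochhammer q q (m ∸ k))
      ⟨ *-nonZeroᶜ (qPochhammer q q k) (qPochhammer q q (m ∸ k)) (q≠ k) (q≠ (m ∸ k)) ⟩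

  hahn : ℕ → (α x y : ℂ) → ℂ
  hahn m α x y =
    Σ< (suc m) λ k → qBinomial m k *ᶜ qPochhammer α q k *ᶜ x ^ᶜ k *ᶜ y ^ᶜ (m ∸ k)

{-# OPTIONS --safe #-}
module Submission where

-- With the q-exponential series e(z) = Σ z^j/(q;q)_j and f(z) = Σ (q^n;q)_k z^k/(q;q)_k, the
-- left-hand side is the Cauchy product of f(by) and e(xy). Both series are instances of
-- φ_α(z) = Σ (α;q)_k z^k/(q;q)_k, whose coefficient recurrence gives the functional equation
-- (1 - z) φ_α(z) = (1 - αz) φ_α(qz). Iterating it, and using φ_α(q^N z) → 1, yields the
-- q-binomial theorem (z;q)_∞ φ_α(z) = (αz;q)_∞. The case α = 0 says that e(z) inverts
-- (z;q)_∞, which also shows constructively that the denominators are nonzero.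

open import Defs
open Defs.RationalLemmas
open Defs.RootLemmas using (module Approx; archimedean; ι; ι-suc; ι-mono-≤; ι-suc>0; /-*-ι)
open import Algebra.Bundles using (CommutativeRing)
import Algebra.Solver.Ring
open import Algebra.Solver.Ring.AlmostCommutativeRing
  using (AlmostCommutativeRing; fromCommutativeRing; _-Raw-AlmostCommutative⟶_)
open import Data.Integer as ℤ using ()
open import Data.Maybe using (Maybe; just; nothing)
open import Data.Nat as ℕ using (ℕ; zero; suc; _∸_)
import Data.Nat.Properties as ℕₚ
open import Data.Product using (Σ-syntax; ∃; _×_; _,_; proj₁; proj₂)
open import Data.Rational as ℚ
  using (ℚ; 0ℚ; 1ℚ; ½; _+_; _*_; _-_; -_; ∣_∣; _<_; _≤_)
import Data.Rational.Properties as ℚₚ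
open import Data.Rational.Solver using (module +-*-Solver)
open import Data.Sum using (inj₁; inj₂)
open import Level using (0ℓ)
open import Relation.Binary.PropositionalEquality
  using (_≡_; refl; sym; trans; cong; cong₂; subst; subst₂)
open import Relation.Nullary using (yes; no)

-- The modulus in the statement is a square root approximated term by term, which is awkward to
-- calculate with. All estimates therefore use `z ≺ r`, which compares the squared modulus with the
-- square of a rational; only `<1⇒≺1` and `⇝⇒⟶` touch the root. A limit exists constructively only
-- with an explicit rate of convergence, so series and products are controlled by bounds K ρ^k with
-- rational ρ < 1. The basic bounds come from a ratio test in which the ratios are a sequence of
-- their own, never quotients of terms, since terms may vanish. The conditions |xy| < 1 and |by| < 1
-- suffice for it because (1 - αq^k)/(1 - q^(k+1)) tends to 1, so that the ratios of φ_α(z) tend to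
-- z. That an infinite product is apart from 0 does not follow from its factors being so; this is
-- why an inverse of it is exhibited.

-- Rational inequalities

p<q⇒0<q-p : ∀ {p q} → p < q → 0ℚ < q - p
p<q⇒0<q-p {p} {q} p<q = subst (_< q - p) (ℚₚ.+-inverseʳ p) (ℚₚ.+-monoˡ-< (- p) p<q)

p≤q⇒0≤q-p : ∀ {p q} → p ≤ q → 0ℚ ≤ q - p
p≤q⇒0≤q-p {p} {q} p≤q = subst (_≤ q - p) (ℚₚ.+-inverseʳ p) (ℚₚ.+-monoˡ-≤ (- p) p≤q)

0≤q-p⇒p≤q : ∀ {p q} → 0ℚ ≤ q - p → p ≤ q
0≤q-p⇒p≤q {p} {q} h = subst₂ _≤_ (ℚₚ.+-identityˡ p)
  (solve 2 (λ p q → (q :- p) :+ p := q) refl p q) (ℚₚ.+-monoˡ-≤ p h)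
  where open +-*-Solver

+-nonNeg : ∀ {p q} → 0ℚ ≤ p → 0ℚ ≤ q → 0ℚ ≤ p + q
+-nonNeg = ℚₚ.+-mono-≤

+-pos : ∀ {p q} → 0ℚ < p → 0ℚ < q → 0ℚ < p + q
+-pos = ℚₚ.+-mono-<

*-nonNeg : ∀ {p q} → 0ℚ ≤ p → 0ℚ ≤ q → 0ℚ ≤ p * q
*-nonNeg {p} {q} 0≤p 0≤q =
  subst (_≤ p * q) (ℚₚ.*-zeroˡ q) (ℚₚ.*-monoʳ-≤-nonNeg q {{ℚ.nonNegative 0≤q}} 0≤p)

*-monoˡ-≤ : ∀ {r p q} → 0ℚ ≤ r → p ≤ q → r * p ≤ r * q
*-monoˡ-≤ {r} 0≤r = ℚₚ.*-monoˡ-≤-nonNeg r {{ℚ.nonNegative 0≤r}}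

*-monoʳ-≤ : ∀ {r p q} → 0ℚ ≤ r → p ≤ q → p * r ≤ q * r
*-monoʳ-≤ {r} 0≤r = ℚₚ.*-monoʳ-≤-nonNeg r {{ℚ.nonNegative 0≤r}}

*-monoˡ-< : ∀ {r p q} → 0ℚ < r → p < q → r * p < r * q
*-monoˡ-< {r} 0<r = ℚₚ.*-monoʳ-<-pos r {{ℚ.positive 0<r}}

*-monoʳ-< : ∀ {r p q} → 0ℚ < r → p < q → p * r < q * r
*-monoʳ-< {r} 0<r = ℚₚ.*-monoˡ-<-pos r {{ℚ.positive 0<r}}

square-nonNeg : ∀ p → 0ℚ ≤ p * p
square-nonNeg p with ℚₚ.≤-total 0ℚ p
... | inj₁ 0≤p = *-nonNeg 0≤p 0≤p
... | inj₂ p≤0 = subst (0ℚ ≤_) (solve 1 (λ p → :- p :* :- p := p :* p) refl p) (*-nonNeg 0≤-p 0≤-p)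
  where
  open +-*-Solver
  0≤-p : 0ℚ ≤ - p
  0≤-p = ℚₚ.neg-antimono-≤ p≤0

square-mono-< : ∀ {p q} → 0ℚ ≤ p → p < q → p * p < q * q
square-mono-< 0≤p p<q =
  ℚₚ.≤-<-trans (*-monoˡ-≤ 0≤p (ℚₚ.<⇒≤ p<q)) (*-monoʳ-< (ℚₚ.≤-<-trans 0≤p p<q) p<q)

square-cancel-≤ : ∀ {p q} → 0ℚ ≤ q → p * p ≤ q * q → p ≤ q
square-cancel-≤ 0≤q pp≤qq =
  ℚₚ.≮⇒≥ λ q<p → ℚₚ.<-irrefl refl (ℚₚ.<-≤-trans (square-mono-< 0≤q q<p) pp≤qq)

-- Lagrange's identity: (ac + bd)² + (ad - bc)² = (a² + b²)(c² + d²). The radii s and t stand in for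
-- the moduli, which need not be rational.
cauchy-schwarz : ∀ {a b c d s t} → 0ℚ ≤ s → 0ℚ ≤ t → a * a + b * b ≤ s * s →
                 c * c + d * d ≤ t * t → a * c + b * d ≤ s * t
cauchy-schwarz {a} {b} {c} {d} {s} {t} 0≤s 0≤t hs ht = square-cancel-≤ (*-nonNeg 0≤s 0≤t) (begin
  (a * c + b * d) * (a * c + b * d)
    ≡⟨ ℚₚ.+-identityʳ _ ⟨
  (a * c + b * d) * (a * c + b * d) + 0ℚ
    ≤⟨ ℚₚ.+-monoʳ-≤ ((a * c + b * d) * (a * c + b * d)) (square-nonNeg (a * d - b * c)) ⟩
  (a * c + b * d) * (a * c + b * d) + (a * d - b * c) * (a * d - b * c)
    ≡⟨ solve 4 (λ a b c d →
         (a :* c :+ b :* d) :* (a :* c :+ b :* d) :+ (a :* d :- b :* c) :* (a :* d :- b :* c)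
           := (a :* a :+ b :* b) :* (c :* c :+ d :* d)) refl a b c d ⟩
  (a * a + b * b) * (c * c + d * d)
    ≤⟨ *-mono-≤ (+-nonNeg (square-nonNeg a) (square-nonNeg b))
         (+-nonNeg (square-nonNeg c) (square-nonNeg d)) hs ht ⟩
  (s * s) * (t * t)
    ≡⟨ solve 2 (λ s t → (s :* s) :* (t :* t) := (s :* t) :* (s :* t)) refl s t ⟩
  (s * t) * (s * t) ∎)
  where
  open ℚₚ.≤-Reasoning
  open +-*-Solver

minkowski : ∀ {a b c d s t} → 0ℚ ≤ s → 0ℚ ≤ t → a * a + b * b ≤ s * s →
            c * c + d * d ≤ t * t →
            (a + c) * (a + c) + (b + d) * (b + d) ≤ (s + t) * (s + t)
minkowski {a} {b} {c} {d} {s} {t} 0≤s 0≤t hs ht = begin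
  (a + c) * (a + c) + (b + d) * (b + d)
    ≡⟨ solve 4 (λ a b c d → (a :+ c) :* (a :+ c) :+ (b :+ d) :* (b :+ d)
         := (a :* a :+ b :* b) :+ (c :* c :+ d :* d)
              :+ ((a :* c :+ b :* d) :+ (a :* c :+ b :* d))) refl a b c d ⟩
  (a * a + b * b) + (c * c + d * d) + ((a * c + b * d) + (a * c + b * d))
    ≤⟨ ℚₚ.+-mono-≤ (ℚₚ.+-mono-≤ hs ht) (ℚₚ.+-mono-≤ cs cs) ⟩
  (s * s) + (t * t) + (s * t + s * t)
    ≡⟨ solve 2 (λ s t → (s :* s) :+ (t :* t) :+ (s :* t :+ s :* t)
         := (s :+ t) :* (s :+ t)) refl s t ⟩
  (s + t) * (s + t) ∎
  where
  open ℚₚ.≤-Reasoning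
  open +-*-Solver
  cs = cauchy-schwarz {a} {b} {c} {d} 0≤s 0≤t hs ht

-- Bounds on complex numbers

infix 4 _≺_ _≈_
infixl 6 _⊖_

-- |z| < r. Because the inequality is strict, it is invariant under _≈_.
record _≺_ (z : ℂ) (r : ℚ) : Set where
  constructor mk≺
  field
    size   : ℚ
    size≥0 : 0ℚ ≤ size
    size<r : size < r
    from   : ℕ
    bound  : ∀ n → from ℕ.≤ n → seq ∣ z ∣² n ≤ size * size

negᶜ : ℂ → ℂ
re (negᶜ z) = -ᴿ re z
im (negᶜ z) = -ᴿ im z

_⊖_ : ℂ → ℂ → ℂ
z ⊖ w = z +ᶜ negᶜ w

record _≈_ (z w : ℂ) : Set where
  constructor mk≈
  field ≈⇒≺ : ∀ {ε} → 0ℚ < ε → z ⊖ w ≺ ε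
open _≈_ public

≺-pos : ∀ {z r} → z ≺ r → 0ℚ < r
≺-pos (mk≺ _ s≥0 s<r _ _) = ℚₚ.≤-<-trans s≥0 s<r

≺-mono : ∀ {z r s} → r ≤ s → z ≺ r → z ≺ s
≺-mono r≤s (mk≺ t t≥0 t<r N h) = mk≺ t t≥0 (ℚₚ.<-≤-trans t<r r≤s) N h

abstract
  -- The strict gap between `size` and r leaves room for a smaller radius. Applied to a number of
  -- modulus below 1, this supplies the ratio ρ < 1 of a geometric bound.
  ≺-open : ∀ {z r} → z ≺ r → ∃ λ s → 0ℚ < s × s < r × z ≺ s
  ≺-open (mk≺ t t≥0 t<r N h) with ℚₚ.<-dense t<r
  ... | s , t<s , s<r = s , ℚₚ.≤-<-trans t≥0 t<s , s<r , mk≺ t t≥0 t<s N h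

≺-+ : ∀ {z w r s} → z ≺ r → w ≺ s → z +ᶜ w ≺ r + s
≺-+ {z} {w} (mk≺ t t≥0 t<r M g) (mk≺ u u≥0 u<s N h) =
  mk≺ (t + u) (+-nonNeg t≥0 u≥0) (ℚₚ.+-mono-< t<r u<s) (M ℕ.⊔ N) λ n ≤n →
    minkowski {seq (re z) n} {seq (im z) n} {seq (re w) n} {seq (im w) n} t≥0 u≥0
      (g n (ℕₚ.m⊔n≤o⇒m≤o M N ≤n)) (h n (ℕₚ.m⊔n≤o⇒n≤o M N ≤n))

∣∣²-* : ∀ z w n → seq ∣ z *ᶜ w ∣² n ≡ seq ∣ z ∣² n * seq ∣ w ∣² n
∣∣²-* z w n =
  solve 4 (λ a b c d → (a :* c :+ :- (b :* d)) :* (a :* c :+ :- (b :* d))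
      :+ (a :* d :+ b :* c) :* (a :* d :+ b :* c)
      := (a :* a :+ b :* b) :* (c :* c :+ d :* d)) refl
    (seq (re z) n) (seq (im z) n) (seq (re w) n) (seq (im w) n)
  where open +-*-Solver

∣∣²-nonNeg : ∀ z n → 0ℚ ≤ seq ∣ z ∣² n
∣∣²-nonNeg z n = +-nonNeg (square-nonNeg (seq (re z) n)) (square-nonNeg (seq (im z) n))

≺-* : ∀ {z w r s} → z ≺ r → w ≺ s → z *ᶜ w ≺ r * s
≺-* {z} {w} z≺r@(mk≺ t t≥0 t<r M g) (mk≺ u u≥0 u<s N h) =
  mk≺ (t * u) (*-nonNeg t≥0 u≥0)
    (ℚₚ.≤-<-trans (*-monoʳ-≤ u≥0 (ℚₚ.<⇒≤ t<r)) (*-monoˡ-< (≺-pos z≺r) u<s)) (M ℕ.⊔ N) λ n ≤n →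
    subst₂ _≤_ (sym (∣∣²-* z w n))
      (solve 2 (λ t u → (t :* t) :* (u :* u) := (t :* u) :* (t :* u)) refl t u)
      (*-mono-≤ (∣∣²-nonNeg z n) (∣∣²-nonNeg w n)
        (g n (ℕₚ.m⊔n≤o⇒m≤o M N ≤n)) (h n (ℕₚ.m⊔n≤o⇒n≤o M N ≤n)))
  where open +-*-Solver

≺-neg : ∀ {z r} → z ≺ r → negᶜ z ≺ r
≺-neg {z} (mk≺ t t≥0 t<r N h) = mk≺ t t≥0 t<r N λ n ≤n →
  subst (_≤ t * t)
    (solve 2 (λ a b → a :* a :+ b :* b := :- a :* :- a :+ :- b :* :- b) refl
      (seq (re z) n) (seq (im z) n)) (h n ≤n)
  where open +-*-Solver

≺-cong-eventually : ∀ {z w r} N →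
  (∀ n → N ℕ.≤ n → seq (re z) n ≡ seq (re w) n) →
  (∀ n → N ℕ.≤ n → seq (im z) n ≡ seq (im w) n) → z ≺ r → w ≺ r
≺-cong-eventually N p q (mk≺ t t≥0 t<r M h) = mk≺ t t≥0 t<r (M ℕ.⊔ N) λ n ≤n →
  let N≤n = ℕₚ.m⊔n≤o⇒n≤o M N ≤n in
  subst₂ (λ a b → a * a + b * b ≤ t * t) (p n N≤n) (q n N≤n) (h n (ℕₚ.m⊔n≤o⇒m≤o M N ≤n))

≺-cong-≡ : ∀ {z w r} → (∀ n → seq (re z) n ≡ seq (re w) n) →
           (∀ n → seq (im z) n ≡ seq (im w) n) → z ≺ r → w ≺ r
≺-cong-≡ p q = ≺-cong-eventually 0 (λ n _ → p n) (λ n _ → q n)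

0≺ : ∀ {r} → 0ℚ < r → 0ᶜ ≺ r
0≺ r>0 = mk≺ 0ℚ ℚₚ.≤-refl r>0 0 λ _ _ → ℚₚ.≤-refl

p<p+1 : ∀ p → p < p + 1ℚ
p<p+1 p = subst (_< p + 1ℚ) (ℚₚ.+-identityʳ p) (ℚₚ.+-monoʳ-< p 0<1)

square-≤ : ∀ p {B} → ∣ p ∣ ≤ B → p * p ≤ B * B
square-≤ p {B} h = subst (_≤ B * B)
  (trans (sym (ℚₚ.∣p*q∣≡∣p∣*∣q∣ p p)) (ℚₚ.0≤p⇒∣p∣≡p (square-nonNeg p)))
  (*-mono-≤ 0≤∣ p ∣ 0≤∣ p ∣ h h)

sum-of-squares≤ : ∀ {A B} → 0ℚ ≤ A → 0ℚ ≤ B → A * A + B * B ≤ (A + B) * (A + B)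
sum-of-squares≤ {A} {B} 0≤A 0≤B = subst₂ _≤_ (ℚₚ.+-identityʳ (A * A + B * B))
  (solve 2 (λ A B → A :* A :+ B :* B :+ (A :* B :+ A :* B) := (A :+ B) :* (A :+ B)) refl A B)
  (ℚₚ.+-monoʳ-≤ (A * A + B * B) (+-nonNeg (*-nonNeg 0≤A 0≤B) (*-nonNeg 0≤A 0≤B)))
  where open +-*-Solver

∣∣²-≤ : ∀ z n {A B} → ∣ seq (re z) n ∣ ≤ A → ∣ seq (im z) n ∣ ≤ B →
        seq ∣ z ∣² n ≤ (A + B) * (A + B)
∣∣²-≤ z n {A} {B} re≤A im≤B = ℚₚ.≤-trans
  (ℚₚ.+-mono-≤ (square-≤ (seq (re z) n) re≤A) (square-≤ (seq (im z) n) im≤B))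
  (sum-of-squares≤ (ℚₚ.≤-trans 0≤∣ seq (re z) n ∣ re≤A) (ℚₚ.≤-trans 0≤∣ seq (im z) n ∣ im≤B))

abstract
  ≺-finite : ∀ z → ∃ λ r → z ≺ r
  ≺-finite z =
    let A , A>0 , M , g = RealBounds.bounded (re z)
        B , B>0 , N , h = RealBounds.bounded (im z)
    in A + B + 1ℚ , mk≺ (A + B) (ℚₚ.<⇒≤ (+-pos A>0 B>0)) (p<p+1 (A + B)) (M ℕ.⊔ N) λ n ≤n →
      ∣∣²-≤ z n (g n (ℕₚ.m⊔n≤o⇒m≤o M N ≤n)) (h n (ℕₚ.m⊔n≤o⇒n≤o M N ≤n))

≺-halves : ∀ {z w ε} → z ≺ ½ * ε → w ≺ ½ * ε → z +ᶜ w ≺ ε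
≺-halves {z} {w} {ε} hz hw = subst (z +ᶜ w ≺_) (halves ε) (≺-+ hz hw)

-- Complex numbers as a commutative ring

≈-eventually : ∀ {z w} N → (∀ n → N ℕ.≤ n → seq (re z) n ≡ seq (re w) n) →
               (∀ n → N ℕ.≤ n → seq (im z) n ≡ seq (im w) n) → z ≈ w
≈-eventually N p q = mk≈ λ ε>0 → ≺-cong-eventually N
  (λ n N≤n → sym (p≡q⇒p-q≡0 (p n N≤n))) (λ n N≤n → sym (p≡q⇒p-q≡0 (q n N≤n))) (0≺ ε>0)
  where
  p≡q⇒p-q≡0 : ∀ {a b} → a ≡ b → a - b ≡ 0ℚ
  p≡q⇒p-q≡0 {a} refl = ℚₚ.+-inverseʳ a

≈-pointwise : ∀ {z w} → (∀ n → seq (re z) n ≡ seq (re w) n) →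
              (∀ n → seq (im z) n ≡ seq (im w) n) → z ≈ w
≈-pointwise p q = ≈-eventually 0 (λ n _ → p n) (λ n _ → q n)

≈-refl : ∀ {z} → z ≈ z
≈-refl = ≈-pointwise (λ _ → refl) (λ _ → refl)

≈-sym : ∀ {z w} → z ≈ w → w ≈ z
≈-sym {z} {w} z≈w = mk≈ λ ε>0 → ≺-cong-≡
  (λ n → lemma (seq (re z) n) (seq (re w) n)) (λ n → lemma (seq (im z) n) (seq (im w) n))
  (≺-neg (≈⇒≺ z≈w ε>0))
  where
  open +-*-Solver
  lemma : ∀ a b → - (a + - b) ≡ b + - a
  lemma = solve 2 (λ a b → :- (a :+ :- b) := b :+ :- a) refl

≈-trans : ∀ {z w v} → z ≈ w → w ≈ v → z ≈ v
≈-trans {z} {w} {v} z≈w w≈v = mk≈ λ ε>0 → ≺-cong-≡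
  (λ n → lemma (seq (re z) n) (seq (re w) n) (seq (re v) n))
  (λ n → lemma (seq (im z) n) (seq (im w) n) (seq (im v) n))
  (≺-halves (≈⇒≺ z≈w (half ε>0)) (≈⇒≺ w≈v (half ε>0)))
  where
  open +-*-Solver
  lemma : ∀ a b c → (a + - b) + (b + - c) ≡ a + - c
  lemma = solve 3 (λ a b c → (a :+ :- b) :+ (b :+ :- c) := a :+ :- c) refl

-- Write w = z - (z - w): if s < r is still a radius for z, the gap r - s absorbs the difference.
≺-resp-≈ : ∀ {z w r} → z ≈ w → z ≺ r → w ≺ r
≺-resp-≈ {z} {w} {r} z≈w z≺r with ≺-open z≺r
... | s , _ , s<r , z≺s = ≺-cong-≡
  (λ n → lemma (seq (re z) n) (seq (re w) n)) (λ n → lemma (seq (im z) n) (seq (im w) n))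
  (subst (z +ᶜ negᶜ (z ⊖ w) ≺_) (solve 2 (λ r s → s :+ (r :- s) := r) refl r s)
    (≺-+ z≺s (≺-neg (≈⇒≺ z≈w (p<q⇒0<q-p s<r)))))
  where
  open +-*-Solver
  lemma : ∀ a b → a + - (a + - b) ≡ b
  lemma = solve 2 (λ a b → a :+ :- (a :+ :- b) := b) refl

+ᶜ-cong : ∀ {z z′ w w′} → z ≈ z′ → w ≈ w′ → z +ᶜ w ≈ z′ +ᶜ w′
+ᶜ-cong {z} {z′} {w} {w′} z≈ w≈ = mk≈ λ ε>0 → ≺-cong-≡
  (λ n → lemma (seq (re z) n) (seq (re z′) n) (seq (re w) n) (seq (re w′) n))
  (λ n → lemma (seq (im z) n) (seq (im z′) n) (seq (im w) n) (seq (im w′) n))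
  (≺-halves (≈⇒≺ z≈ (half ε>0)) (≈⇒≺ w≈ (half ε>0)))
  where
  open +-*-Solver
  lemma : ∀ a b c d → (a + - b) + (c + - d) ≡ (a + c) + - (b + d)
  lemma = solve 4 (λ a b c d → (a :+ :- b) :+ (c :+ :- d) := (a :+ c) :+ :- (b :+ d)) refl

negᶜ-cong : ∀ {z w} → z ≈ w → negᶜ z ≈ negᶜ w
negᶜ-cong {z} {w} z≈w = mk≈ λ ε>0 → ≺-cong-≡
  (λ n → lemma (seq (re z) n) (seq (re w) n)) (λ n → lemma (seq (im z) n) (seq (im w) n))
  (≺-neg (≈⇒≺ z≈w ε>0))
  where
  open +-*-Solver
  lemma : ∀ a b → - (a + - b) ≡ - a + - - b
  lemma = solve 2 (λ a b → :- (a :+ :- b) := :- a :+ :- (:- b)) refl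

≺-scale : ∀ {z w K ε} (K>0 : 0ℚ < K) → w ≺ K → z ≺ inv K>0 * ε → w *ᶜ z ≺ ε
≺-scale {z} {w} {K} {ε} K>0 hw hz = subst (w *ᶜ z ≺_) (*-inv-cancel K>0 ε) (≺-* hw hz)

bounded*small : ∀ {v z} → (∀ {ε} → 0ℚ < ε → z ≺ ε) → ∀ {ε} → 0ℚ < ε → v *ᶜ z ≺ ε
bounded*small {v} {z} small {ε} ε>0 =
  let K , v≺K = ≺-finite v
      K>0 = ≺-pos v≺K
  in ≺-scale {z} {v} {K} {ε} K>0 v≺K (small {inv K>0 * ε} (*-pos (inv-pos K>0) ε>0))

*ᶜ-comm : ∀ z w → z *ᶜ w ≈ w *ᶜ z
*ᶜ-comm z w = ≈-pointwise
  (λ n → solve 4 (λ a b c d → a :* c :+ :- (b :* d) := c :* a :+ :- (d :* b)) refl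
    (seq (re z) n) (seq (im z) n) (seq (re w) n) (seq (im w) n))
  (λ n → solve 4 (λ a b c d → a :* d :+ b :* c := c :* b :+ d :* a) refl
    (seq (re z) n) (seq (im z) n) (seq (re w) n) (seq (im w) n))
  where open +-*-Solver

*ᶜ-congˡ : ∀ v {z w} → z ≈ w → v *ᶜ z ≈ v *ᶜ w
*ᶜ-congˡ v {z} {w} z≈w = mk≈ λ {ε} ε>0 → ≺-cong-≡ {v *ᶜ (z ⊖ w)}
  (λ n → re-lemma (seq (re v) n) (seq (im v) n) (seq (re z) n) (seq (im z) n)
                  (seq (re w) n) (seq (im w) n))
  (λ n → im-lemma (seq (re v) n) (seq (im v) n) (seq (re z) n) (seq (im z) n)
                  (seq (re w) n) (seq (im w) n))
  (bounded*small (λ ε>0 → ≈⇒≺ z≈w ε>0) ε>0)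
  where
  open +-*-Solver
  re-lemma : ∀ a b c d e f →
    a * (c + - e) + - (b * (d + - f)) ≡ (a * c + - (b * d)) + - (a * e + - (b * f))
  re-lemma = solve 6 (λ a b c d e f → a :* (c :+ :- e) :+ :- (b :* (d :+ :- f))
      := (a :* c :+ :- (b :* d)) :+ :- (a :* e :+ :- (b :* f))) refl
  im-lemma : ∀ a b c d e f →
    a * (d + - f) + b * (c + - e) ≡ (a * d + b * c) + - (a * f + b * e)
  im-lemma = solve 6 (λ a b c d e f → a :* (d :+ :- f) :+ b :* (c :+ :- e)
      := (a :* d :+ b :* c) :+ :- (a :* f :+ b :* e)) refl

*ᶜ-cong : ∀ {z z′ w w′} → z ≈ z′ → w ≈ w′ → z *ᶜ w ≈ z′ *ᶜ w′
*ᶜ-cong {z} {z′} {w} {w′} z≈ w≈ = ≈-trans (*ᶜ-congˡ z w≈)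
  (≈-trans (*ᶜ-comm z w′) (≈-trans (*ᶜ-congˡ w′ z≈) (*ᶜ-comm w′ z′)))

*ᶜ-assoc : ∀ z w v → (z *ᶜ w) *ᶜ v ≈ z *ᶜ (w *ᶜ v)
*ᶜ-assoc z w v = ≈-pointwise
  (λ n → re-lemma (seq (re z) n) (seq (im z) n) (seq (re w) n) (seq (im w) n)
                  (seq (re v) n) (seq (im v) n))
  (λ n → im-lemma (seq (re z) n) (seq (im z) n) (seq (re w) n) (seq (im w) n)
                  (seq (re v) n) (seq (im v) n))
  where
  open +-*-Solver
  re-lemma : ∀ a b c d e f → (a * c + - (b * d)) * e + - ((a * d + b * c) * f)
    ≡ a * (c * e + - (d * f)) + - (b * (c * f + d * e))
  re-lemma = solve 6 (λ a b c d e f →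
    (a :* c :+ :- (b :* d)) :* e :+ :- ((a :* d :+ b :* c) :* f)
      := a :* (c :* e :+ :- (d :* f)) :+ :- (b :* (c :* f :+ d :* e))) refl
  im-lemma : ∀ a b c d e f → (a * c + - (b * d)) * f + (a * d + b * c) * e
    ≡ a * (c * f + d * e) + b * (c * e + - (d * f))
  im-lemma = solve 6 (λ a b c d e f →
    (a :* c :+ :- (b :* d)) :* f :+ (a :* d :+ b :* c) :* e
      := a :* (c :* f :+ d :* e) :+ b :* (c :* e :+ :- (d :* f))) refl

*ᶜ-identityˡ : ∀ z → 1ᶜ *ᶜ z ≈ z
*ᶜ-identityˡ z = ≈-pointwise
  (λ n → solve 2 (λ a b → con 1ℚ :* a :+ :- (con 0ℚ :* b) := a) refl (seq (re z) n) (seq (im z) n))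
  (λ n → solve 2 (λ a b → con 1ℚ :* b :+ con 0ℚ :* a := b) refl (seq (re z) n) (seq (im z) n))
  where open +-*-Solver

*ᶜ-distribˡ : ∀ z w v → z *ᶜ (w +ᶜ v) ≈ z *ᶜ w +ᶜ z *ᶜ v
*ᶜ-distribˡ z w v = ≈-pointwise
  (λ n → re-lemma (seq (re z) n) (seq (im z) n) (seq (re w) n) (seq (im w) n)
                  (seq (re v) n) (seq (im v) n))
  (λ n → im-lemma (seq (re z) n) (seq (im z) n) (seq (re w) n) (seq (im w) n)
                  (seq (re v) n) (seq (im v) n))
  where
  open +-*-Solver
  re-lemma : ∀ a b c d e f →
    a * (c + e) + - (b * (d + f)) ≡ (a * c + - (b * d)) + (a * e + - (b * f))
  re-lemma = solve 6 (λ a b c d e f → a :* (c :+ e) :+ :- (b :* (d :+ f))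
    := (a :* c :+ :- (b :* d)) :+ (a :* e :+ :- (b :* f))) refl
  im-lemma : ∀ a b c d e f → a * (d + f) + b * (c + e) ≡ (a * d + b * c) + (a * f + b * e)
  im-lemma = solve 6 (λ a b c d e f → a :* (d :+ f) :+ b :* (c :+ e)
    := (a :* d :+ b :* c) :+ (a :* f :+ b :* e)) refl

ℂ-commutativeRing : CommutativeRing 0ℓ 0ℓ
ℂ-commutativeRing = record
  { Carrier = ℂ ; _≈_ = _≈_ ; _+_ = _+ᶜ_ ; _*_ = _*ᶜ_ ; -_ = negᶜ ; 0# = 0ᶜ ; 1# = 1ᶜ
  ; isCommutativeRing = record
    { isRing = record
      { +-isAbelianGroup = record
        { isGroup = record
          { isMonoid = record
            { isSemigroup = record
              { isMagma = record
                { isEquivalence = record { refl = ≈-refl ; sym = ≈-sym ; trans = ≈-trans }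
                ; ∙-cong = +ᶜ-cong }
              ; assoc = λ z w v → ≈-pointwise
                  (λ n → ℚₚ.+-assoc (seq (re z) n) (seq (re w) n) (seq (re v) n))
                  (λ n → ℚₚ.+-assoc (seq (im z) n) (seq (im w) n) (seq (im v) n)) }
            ; identity =
                (λ z → ≈-pointwise (λ n → ℚₚ.+-identityˡ (seq (re z) n))
                                   (λ n → ℚₚ.+-identityˡ (seq (im z) n)))
              , (λ z → ≈-pointwise (λ n → ℚₚ.+-identityʳ (seq (re z) n))
                                   (λ n → ℚₚ.+-identityʳ (seq (im z) n))) }
          ; inverse =
              (λ z → ≈-pointwise (λ n → ℚₚ.+-inverseˡ (seq (re z) n))
                                 (λ n → ℚₚ.+-inverseˡ (seq (im z) n)))
            , (λ z → ≈-pointwise (λ n → ℚₚ.+-inverseʳ (seq (re z) n))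
                                 (λ n → ℚₚ.+-inverseʳ (seq (im z) n)))
          ; ⁻¹-cong = negᶜ-cong }
        ; comm = λ z w → ≈-pointwise (λ n → ℚₚ.+-comm (seq (re z) n) (seq (re w) n))
                                     (λ n → ℚₚ.+-comm (seq (im z) n) (seq (im w) n)) }
      ; *-cong = *ᶜ-cong
      ; *-assoc = *ᶜ-assoc
      ; *-identity = *ᶜ-identityˡ , λ z → ≈-trans (*ᶜ-comm z 1ᶜ) (*ᶜ-identityˡ z)
      ; distrib = *ᶜ-distribˡ , λ z w v → ≈-trans (*ᶜ-comm (w +ᶜ v) z)
          (≈-trans (*ᶜ-distribˡ z w v) (+ᶜ-cong (*ᶜ-comm z w) (*ᶜ-comm z v))) }
    ; *-comm = *ᶜ-comm } }

constᶜ : ℚ → ℂ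
re (constᶜ p) = constᴿ p
im (constᶜ p) = 0ᴿ

-- The coefficients 0 and 1 must evaluate to 0ᶜ and 1ᶜ themselves for the ring solver
-- to match them against goals.
coeff : ℚ → ℂ
coeff p with p ℚₚ.≟ 0ℚ | p ℚₚ.≟ 1ℚ
... | yes _ | _     = 0ᶜ
... | no _  | yes _ = 1ᶜ
... | no _  | no _  = constᶜ p

coeff≈constᶜ : ∀ p → coeff p ≈ constᶜ p
coeff≈constᶜ p with p ℚₚ.≟ 0ℚ | p ℚₚ.≟ 1ℚ
... | yes refl | _        = ≈-pointwise (λ _ → refl) (λ _ → refl)
... | no _     | yes refl = ≈-pointwise (λ _ → refl) (λ _ → refl)
... | no _     | no _     = ≈-refl

ℂ-almostCommutativeRing : AlmostCommutativeRing 0ℓ 0ℓ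
ℂ-almostCommutativeRing = fromCommutativeRing ℂ-commutativeRing

coeff-morphism :
  CommutativeRing.rawRing ℚₚ.+-*-commutativeRing -Raw-AlmostCommutative⟶ ℂ-almostCommutativeRing
coeff-morphism = record
  { ⟦_⟧ = coeff
  ; +-homo = λ p q → ≈-trans (coeff≈constᶜ (p + q)) (≈-trans
      (≈-pointwise (λ _ → refl) (λ _ → refl))
      (≈-sym (+ᶜ-cong (coeff≈constᶜ p) (coeff≈constᶜ q))))
  ; *-homo = λ p q → ≈-trans (coeff≈constᶜ (p * q)) (≈-trans
      (≈-pointwise (λ _ → solve 2 (λ p q → p :* q := p :* q :+ :- (con 0ℚ :* con 0ℚ)) refl p q)
                   (λ _ → solve 2 (λ p q → con 0ℚ := p :* con 0ℚ :+ con 0ℚ :* q) refl p q))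
      (≈-sym (*ᶜ-cong (coeff≈constᶜ p) (coeff≈constᶜ q))))
  ; -‿homo = λ p → ≈-trans (coeff≈constᶜ (- p)) (≈-trans
      (≈-pointwise (λ _ → refl) (λ _ → refl)) (≈-sym (negᶜ-cong (coeff≈constᶜ p))))
  ; 0-homo = ≈-refl
  ; 1-homo = ≈-refl }
  where open +-*-Solver

coeff≟ : ∀ p q → Maybe (coeff p ≈ coeff q)
coeff≟ p q with p ℚₚ.≟ q
... | yes refl = just ≈-refl
... | no _     = nothing

module ℂ-Solver = Algebra.Solver.Ring
  (CommutativeRing.rawRing ℚₚ.+-*-commutativeRing) ℂ-almostCommutativeRing coeff-morphism coeff≟

-- Inverses

module _ (z : ℂ) (z≠0 : NonZeroᶜ z) where
  private
    module I = Inverse ∣ z ∣² z≠0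
    i : ℕ → ℚ
    i n = inv (I.pos n)

  ∣∣²*inv : ∀ n → _<ᴿ_.from z≠0 ℕ.≤ n → seq ∣ z ∣² n * i n ≡ 1ℚ
  ∣∣²*inv n ≤n = trans (cong (_* i n) (sym (I.unchanged n ≤n))) (*-inv (I.pos n))

  *ᶜ-inverseʳ : z *ᶜ invᶜ z z≠0 ≈ 1ᶜ
  *ᶜ-inverseʳ = ≈-eventually (_<ᴿ_.from z≠0)
    (λ n ≤n → trans (re-lemma (seq (re z) n) (seq (im z) n) (i n)) (∣∣²*inv n ≤n))
    (λ n _ → im-lemma (seq (re z) n) (seq (im z) n) (i n))
    where
    open +-*-Solver
    re-lemma : ∀ a b i → a * (a * i) + - (b * (- b * i)) ≡ (a * a + b * b) * i
    re-lemma = solve 3 (λ a b i → a :* (a :* i) :+ :- (b :* (:- b :* i))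
      := (a :* a :+ b :* b) :* i) refl
    im-lemma : ∀ a b i → a * (- b * i) + b * (a * i) ≡ 0ℚ
    im-lemma = solve 3 (λ a b i → a :* (:- b :* i) :+ b :* (a :* i) := con 0ℚ) refl

  -- |z| ≥ c gives |1/z| ≤ 1/c: both |1/z|² and the reciprocal of |z|² are the number i.
  invᶜ≺ : ∀ {c r} (c>0 : 0ℚ < c) → inv c>0 < r →
          (∃ λ N → ∀ n → N ℕ.≤ n → c * c ≤ seq ∣ z ∣² n) → invᶜ z z≠0 ≺ r
  invᶜ≺ {c} c>0 1/c<r (N , above) =
    mk≺ (inv c>0) (ℚₚ.<⇒≤ (inv-pos c>0)) 1/c<r (N ℕ.⊔ N₀) λ n ≤n →
      let open ℚₚ.≤-Reasoning
          D = seq ∣ z ∣² n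
          k = inv c>0
          eq = ∣∣²*inv n (ℕₚ.m⊔n≤o⇒n≤o N N₀ ≤n)
      in begin
        seq ∣ invᶜ z z≠0 ∣² n       ≡⟨ norm (seq (re z) n) (seq (im z) n) (i n) ⟩
        D * i n * i n               ≡⟨ trans (cong (_* i n) eq) (ℚₚ.*-identityˡ (i n)) ⟩
        i n                         ≡⟨ unit {c} {k} (*-inv c>0) (i n) ⟨
        (k * k) * ((c * c) * i n)   ≤⟨ *-monoˡ-≤ (square-nonNeg k) (*-monoʳ-≤
                                         (ℚₚ.<⇒≤ (inv-pos (I.pos n)))
                                         (above n (ℕₚ.m⊔n≤o⇒m≤o N N₀ ≤n))) ⟩
        (k * k) * (D * i n)         ≡⟨ trans (cong ((k * k) *_) eq) (ℚₚ.*-identityʳ (k * k)) ⟩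
        k * k                       ∎
    where
    open +-*-Solver
    N₀ = _<ᴿ_.from z≠0
    norm : ∀ a b i → (a * i) * (a * i) + (- b * i) * (- b * i) ≡ (a * a + b * b) * i * i
    norm = solve 3 (λ a b i → (a :* i) :* (a :* i) :+ (:- b :* i) :* (:- b :* i)
      := (a :* a :+ b :* b) :* i :* i) refl
    unit : ∀ {c k} → c * k ≡ 1ℚ → ∀ i → (k * k) * ((c * c) * i) ≡ i
    unit {c} {k} eq i = trans
      (solve 3 (λ c k i → (k :* k) :* ((c :* c) :* i) := (c :* k) :* ((c :* k) :* i)) refl c k i)
      (trans (cong (λ u → u * (u * i)) eq)
        (trans (ℚₚ.*-identityˡ (1ℚ * i)) (ℚₚ.*-identityˡ i)))

-ᶜ≈⊖ : ∀ z w → z -ᶜ w ≈ z ⊖ w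
-ᶜ≈⊖ z w = ≈-pointwise (λ _ → refl) (λ _ → refl)

-- The real part suffices: |1 - d| ≥ 1 - Re d ≥ 1 - r, and r ≤ 1 permits squaring.
∣1-∣²-lower : ∀ {d r} → d ≺ r → r ≤ 1ℚ →
              ∃ λ N → ∀ n → N ℕ.≤ n → (1ℚ - r) * (1ℚ - r) ≤ seq ∣ 1ᶜ -ᶜ d ∣² n
∣1-∣²-lower {d} {r} (mk≺ s s≥0 s<r N h) r≤1 = N , λ n ≤n →
  let a = seq (re d) n
      b = seq (im d) n
      a≤r : a ≤ r
      a≤r = ℚₚ.≤-trans (square-cancel-≤ s≥0 (ℚₚ.≤-trans (a²≤ a b) (h n ≤n))) (ℚₚ.<⇒≤ s<r)
      1-r≤1-a : 1ℚ - r ≤ 1ℚ - a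
      1-r≤1-a = ℚₚ.+-monoʳ-≤ 1ℚ (ℚₚ.neg-antimono-≤ a≤r)
      1-r≥0 = p≤q⇒0≤q-p r≤1
  in ℚₚ.≤-trans (*-mono-≤ 1-r≥0 1-r≥0 1-r≤1-a 1-r≤1-a) (a²≤ (1ℚ - a) (0ℚ + - b))
  where
  a²≤ : ∀ a b → a * a ≤ a * a + b * b
  a²≤ a b = subst (_≤ a * a + b * b) (ℚₚ.+-identityʳ (a * a))
    (ℚₚ.+-monoʳ-≤ (a * a) (square-nonNeg b))

nonZero-1- : ∀ {d r} → d ≺ r → r < 1ℚ → NonZeroᶜ (1ᶜ -ᶜ d)
nonZero-1- {d} {r} d≺r r<1 =
  let N , above = ∣1-∣²-lower d≺r (ℚₚ.<⇒≤ r<1) in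
  mk< ((1ℚ - r) * (1ℚ - r)) (*-pos (p<q⇒0<q-p r<1) (p<q⇒0<q-p r<1)) N λ n ≤n →
    subst (_≤ seq ∣ 1ᶜ -ᶜ d ∣² n) (sym (ℚₚ.+-identityˡ ((1ℚ - r) * (1ℚ - r)))) (above n ≤n)

invᶜ-1-≺ : ∀ {d r} → d ≺ r → (r<1 : r < 1ℚ) → (nz : NonZeroᶜ (1ᶜ -ᶜ d)) →
           invᶜ (1ᶜ -ᶜ d) nz ≺ inv (p<q⇒0<q-p r<1) + 1ℚ
invᶜ-1-≺ {d} d≺r r<1 nz =
  invᶜ≺ (1ᶜ -ᶜ d) nz (p<q⇒0<q-p r<1) (p<p+1 _) (∣1-∣²-lower d≺r (ℚₚ.<⇒≤ r<1))

½<1 : ½ < 1ℚ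
½<1 = subst₂ _<_ (ℚₚ.+-identityʳ ½) refl (ℚₚ.+-monoʳ-< ½ (half 0<1))

-- Eventually |zw| ≥ 1/2 and |w| ≤ K, hence |z|² ≥ (1/2)²/K². This lower bound is the gap `δ`.
unit⇒nonZero : ∀ {z w} → z *ᶜ w ≈ 1ᶜ → NonZeroᶜ z
unit⇒nonZero {z} {w} zw≈1 =
  let K , w≺K = ≺-finite w
      K>0 = ≺-pos w≺K
      mk≺ k k≥0 k<K M g = w≺K
      d≺½ : 1ᶜ ⊖ z *ᶜ w ≺ ½
      d≺½ = ≈⇒≺ (≈-sym zw≈1) (half 0<1)
      N , above = ∣1-∣²-lower d≺½ (ℚₚ.<⇒≤ ½<1)
      δ = inv (*-pos K>0 K>0) * (½ * ½)
  in mk< δ (*-pos (inv-pos (*-pos K>0 K>0)) (*-pos (half 0<1) (half 0<1))) (M ℕ.⊔ N) λ n ≤n →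
    subst (_≤ seq ∣ z ∣² n) (sym (ℚₚ.+-identityˡ δ))
      (ℚₚ.*-cancelˡ-≤-pos (K * K) {{ℚ.positive (*-pos K>0 K>0)}} (begin
        (K * K) * δ                       ≡⟨ *-inv-cancel (*-pos K>0 K>0) (½ * ½) ⟩
        ½ * ½                             ≤⟨ above n (ℕₚ.m⊔n≤o⇒n≤o M N ≤n) ⟩
        seq ∣ 1ᶜ -ᶜ (1ᶜ ⊖ z *ᶜ w) ∣² n    ≡⟨ cong₂ (λ a b → a * a + b * b)
                                               (lemma 1ℚ (seq (re (z *ᶜ w)) n))
                                               (lemma 0ℚ (seq (im (z *ᶜ w)) n)) ⟩
        seq ∣ z *ᶜ w ∣² n                 ≡⟨ ∣∣²-* z w n ⟩
        seq ∣ z ∣² n * seq ∣ w ∣² n       ≤⟨ *-monoˡ-≤ (∣∣²-nonNeg z n)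
                                               (ℚₚ.≤-trans (g n (ℕₚ.m⊔n≤o⇒m≤o M N ≤n))
                                                 (*-mono-≤ k≥0 k≥0 (ℚₚ.<⇒≤ k<K) (ℚₚ.<⇒≤ k<K))) ⟩
        seq ∣ z ∣² n * (K * K)            ≡⟨ ℚₚ.*-comm (seq ∣ z ∣² n) (K * K) ⟩
        (K * K) * seq ∣ z ∣² n            ∎))
  where
  open ℚₚ.≤-Reasoning
  open +-*-Solver
  lemma : ∀ a b → a + - (a + - b) ≡ b
  lemma = solve 2 (λ a b → a :+ :- (a :+ :- b) := b) refl

-- Limits and completeness

infix 4 _⇝_

-- Convergence measured with rational ε; ⇝⇒⟶ relates it to _⟶_.
record _⇝_ (s : ℕ → ℂ) (ℓ : ℂ) : Set where
  constructor mk⇝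
  field ⇝⇒≺ : ∀ {ε} → 0ℚ < ε → ∃ λ N → ∀ n → N ℕ.≤ n → s n ⊖ ℓ ≺ ε
open _⇝_ public

⇝-cong : ∀ {s t ℓ m} → (∀ n → s n ≈ t n) → ℓ ≈ m → s ⇝ ℓ → t ⇝ m
⇝-cong s≈t ℓ≈m s⇝ℓ = mk⇝ λ ε>0 → let N , h = ⇝⇒≺ s⇝ℓ ε>0 in
  N , λ n ≤n → ≺-resp-≈ (+ᶜ-cong (s≈t n) (negᶜ-cong ℓ≈m)) (h n ≤n)

⇝-const : ∀ ℓ → (λ _ → ℓ) ⇝ ℓ
⇝-const ℓ = mk⇝ λ ε>0 → 0 , λ _ _ → ≈⇒≺ (≈-refl {ℓ}) ε>0

⇝-suc : ∀ {s ℓ} → s ⇝ ℓ → (λ n → s (suc n)) ⇝ ℓ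
⇝-suc s⇝ℓ = mk⇝ λ ε>0 → let N , h = ⇝⇒≺ s⇝ℓ ε>0 in
  N , λ n ≤n → h (suc n) (ℕₚ.m≤n⇒m≤1+n ≤n)

⇝-+ : ∀ {s t ℓ m} → s ⇝ ℓ → t ⇝ m → (λ n → s n +ᶜ t n) ⇝ ℓ +ᶜ m
⇝-+ {s} {t} {ℓ} {m} s⇝ℓ t⇝m = mk⇝ λ ε>0 →
  let M , g = ⇝⇒≺ s⇝ℓ (half ε>0)
      N , h = ⇝⇒≺ t⇝m (half ε>0)
  in M ℕ.⊔ N , λ n ≤n →
    ≺-resp-≈ (solve 4 (λ s ℓ t m → (s :- ℓ) :+ (t :- m) := (s :+ t) :- (ℓ :+ m)) ≈-refl
        (s n) ℓ (t n) m)
      (≺-halves (g n (ℕₚ.m⊔n≤o⇒m≤o M N ≤n)) (h n (ℕₚ.m⊔n≤o⇒n≤o M N ≤n)))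
  where open ℂ-Solver

⇝-neg : ∀ {s ℓ} → s ⇝ ℓ → (λ n → negᶜ (s n)) ⇝ negᶜ ℓ
⇝-neg {s} {ℓ} s⇝ℓ = mk⇝ λ ε>0 → let N , h = ⇝⇒≺ s⇝ℓ ε>0 in
  N , λ n ≤n → ≺-resp-≈ (solve 2 (λ s ℓ → :- (s :- ℓ) := :- s :- :- ℓ) ≈-refl (s n) ℓ)
    (≺-neg (h n ≤n))
  where open ℂ-Solver

⇝-eventually-≺ : ∀ {s ℓ r} → s ⇝ ℓ → ℓ ≺ r → ∃ λ N → ∀ n → N ℕ.≤ n → s n ≺ r
⇝-eventually-≺ {s} {ℓ} {r} s⇝ℓ ℓ≺r =
  let t , _ , t<r , ℓ≺t = ≺-open ℓ≺r
      N , h = ⇝⇒≺ s⇝ℓ (p<q⇒0<q-p t<r)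
  in N , λ n ≤n → ≺-resp-≈ (C.solve 2 (λ ℓ s → ℓ C.:+ (s C.:- ℓ) C.:= s) ≈-refl ℓ (s n))
    (subst (ℓ +ᶜ (s n ⊖ ℓ) ≺_) (Q.solve 2 (λ t r → t Q.:+ (r Q.:- t) Q.:= r) refl t r)
      (≺-+ ℓ≺t (h n ≤n)))
  where
  module C = ℂ-Solver
  module Q = +-*-Solver

-- In the limit a strict bound by r becomes a weak one, so strictness costs an enlargement to r′.
-- This is the origin of the added 1 in the constants of later limit estimates.
⇝-limit-≺ : ∀ {s ℓ r r′} → s ⇝ ℓ → (∃ λ N → ∀ n → N ℕ.≤ n → s n ≺ r) → r < r′ → ℓ ≺ r′
⇝-limit-≺ {s} {ℓ} {r} {r′} s⇝ℓ (M , s≺r) r<r′ =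
  let N , h = ⇝⇒≺ s⇝ℓ (p<q⇒0<q-p r<r′)
      n = M ℕ.⊔ N
  in ≺-resp-≈ (C.solve 2 (λ ℓ s → s C.:- (s C.:- ℓ) C.:= ℓ) ≈-refl ℓ (s n))
    (subst (s n ⊖ (s n ⊖ ℓ) ≺_) (Q.solve 2 (λ t r → t Q.:+ (r Q.:- t) Q.:= r) refl r r′)
      (≺-+ (s≺r n (ℕₚ.m≤m⊔n M N)) (≺-neg (h n (ℕₚ.m≤n⊔m M N)))))
  where
  module C = ℂ-Solver
  module Q = +-*-Solver

⇝-* : ∀ {s t ℓ m} → s ⇝ ℓ → t ⇝ m → (λ n → s n *ᶜ t n) ⇝ ℓ *ᶜ m
⇝-* {s} {t} {ℓ} {m} s⇝ℓ t⇝m = mk⇝ λ {ε} ε>0 →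
  let A , ℓ≺A = ≺-finite ℓ
      B , m≺B = ≺-finite m
      A>0 = ≺-pos ℓ≺A
      B>0 = ≺-pos m≺B
      M₁ , g₁ = ⇝⇒≺ s⇝ℓ {inv B>0 * (½ * ε)} (*-pos (inv-pos B>0) (half ε>0))
      M₂ , g₂ = ⇝-eventually-≺ s⇝ℓ ℓ≺A
      M = M₁ ℕ.⊔ M₂
      N , h = ⇝⇒≺ t⇝m {inv A>0 * (½ * ε)} (*-pos (inv-pos A>0) (half ε>0))
  in M ℕ.⊔ N , λ n ≤n →
    let M≤n = ℕₚ.m⊔n≤o⇒m≤o M N ≤n in
    ≺-resp-≈ (solve 4 (λ s ℓ t m → s :* (t :- m) :+ m :* (s :- ℓ) := s :* t :- ℓ :* m) ≈-refl
        (s n) ℓ (t n) m)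
      (≺-halves
        (≺-scale {t n ⊖ m} {s n} {A} {½ * ε} A>0 (g₂ n (ℕₚ.m⊔n≤o⇒n≤o M₁ M₂ M≤n))
          (h n (ℕₚ.m⊔n≤o⇒n≤o M N ≤n)))
        (≺-scale {s n ⊖ ℓ} {m} {B} {½ * ε} B>0 m≺B (g₁ n (ℕₚ.m⊔n≤o⇒m≤o M₁ M₂ M≤n))))
  where open ℂ-Solver

⇝-unique : ∀ {s ℓ m} → s ⇝ ℓ → s ⇝ m → ℓ ≈ m
⇝-unique {s} {ℓ} {m} s⇝ℓ s⇝m = mk≈ λ ε>0 →
  let M , g = ⇝⇒≺ s⇝ℓ (half ε>0)
      N , h = ⇝⇒≺ s⇝m (half ε>0)
      n = M ℕ.⊔ N
  in ≺-resp-≈ (solve 3 (λ s ℓ m → (:- (s :- ℓ)) :+ (s :- m) := ℓ :- m) ≈-refl (s n) ℓ m)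
       (≺-halves (≺-neg (g n (ℕₚ.m≤m⊔n M N))) (h n (ℕₚ.m≤n⊔m M N)))
  where open ℂ-Solver

1/suc : ℕ → ℚ
1/suc n = ℚ._/_ (ℤ.+ 1) (suc n)

1/suc>0 : ∀ n → 0ℚ < 1/suc n
1/suc>0 n = ℚₚ.positive⁻¹ (1/suc n) {{ℚₚ.normalize-pos 1 (suc n)}}

∣p-r∣<ε : ∀ {p q r δ η} → ∣ p - q ∣ < δ → ∣ q - r ∣ < η → ∣ p - r ∣ < δ + η
∣p-r∣<ε {p} {q} {r} {δ} {η} hpq hqr = subst (λ u → ∣ u ∣ < δ + η)
  (solve 3 (λ p q r → (p :- q) :+ (q :- r) := p :- r) refl p q r)
  (ℚₚ.≤-<-trans (ℚₚ.∣p+q∣≤∣p∣+∣q∣ (p - q) (q - r)) (ℚₚ.+-mono-< hpq hqr))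
  where open +-*-Solver

-- K may depend on m and n: each real is given only up to a null sequence, so no index common to all
-- members can be expected.
Cauchyᴿ : (ℕ → ℝ) → Set
Cauchyᴿ x = ∀ ε → 0ℚ < ε → ∃ λ N → ∀ m n → N ℕ.≤ m → N ℕ.≤ n →
  ∃ λ K → ∀ k → K ℕ.≤ k → ∣ seq (x m) k - seq (x n) k ∣ < ε

-- The limit takes at index j a late term of a late member of the sequence; how late
-- is dictated by the precision 1/(j+1).
module Diagonal (x : ℕ → ℝ) (x-cauchy : Cauchyᴿ x) where

  M P : ℕ → ℕ
  M j = proj₁ (x-cauchy (1/suc j) (1/suc>0 j))
  P j = proj₁ (cauchy (x (M j)) (1/suc j) (1/suc>0 j))

  ℓ : ℕ → ℚ
  ℓ j = seq (x (M j)) (P j)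

  -- One 1/(j+1) pays for replacing x n by x (M j), the other for freezing the latter at its term of
  -- index P j.
  near : ∀ j n → M j ℕ.≤ n → ∃ λ K → ∀ k → K ℕ.≤ k → ∣ seq (x n) k - ℓ j ∣ < 1/suc j + 1/suc j
  near j n ≤n =
    let K , h = proj₂ (x-cauchy (1/suc j) (1/suc>0 j)) n (M j) ≤n ℕₚ.≤-refl
    in K ℕ.⊔ P j , λ k ≤k → ∣p-r∣<ε {seq (x n) k} {seq (x (M j)) k} {ℓ j}
      (h k (ℕₚ.m⊔n≤o⇒m≤o K (P j) ≤k))
      (proj₂ (cauchy (x (M j)) (1/suc j) (1/suc>0 j)) k (P j)
        (ℕₚ.m⊔n≤o⇒n≤o K (P j) ≤k) ℕₚ.≤-refl)

  small : ∀ {ε} → 0ℚ < ε → ∃ λ J → ∀ j → J ℕ.≤ j → 1/suc j + 1/suc j < ½ * ε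
  small {ε} ε>0 =
    let J , h = archimedean (½ * (½ * ε)) (half (half ε>0))
    in J , λ j ≤j → subst (1/suc j + 1/suc j <_) (halves (½ * ε)) (ℚₚ.+-mono-< (h j ≤j) (h j ≤j))

  ℓ-cauchy : Cauchy ℓ
  ℓ-cauchy ε ε>0 =
    let J , h = small ε>0 in
    J , λ i j ≤i ≤j →
      -- ℓ i and ℓ j stem from different members; both are compared with a late term of one member
      -- beyond M i and M j.
      let n = M i ℕ.⊔ M j
          K₁ , g₁ = near i n (ℕₚ.m≤m⊔n (M i) (M j))
          K₂ , g₂ = near j n (ℕₚ.m≤n⊔m (M i) (M j))
          k = K₁ ℕ.⊔ K₂
      in subst (∣ ℓ i - ℓ j ∣ <_) (halves ε) (∣p-r∣<ε {ℓ i} {seq (x n) k} {ℓ j}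
           (ℚₚ.<-trans (subst (_< 1/suc i + 1/suc i) (∣p-q∣≡∣q-p∣ (seq (x n) k) (ℓ i))
             (g₁ k (ℕₚ.m≤m⊔n K₁ K₂))) (h i ≤i))
           (ℚₚ.<-trans (g₂ k (ℕₚ.m≤n⊔m K₁ K₂)) (h j ≤j)))

  limit : ℝ
  limit = mkℝ ℓ ℓ-cauchy

  converges : ∀ {ε} → 0ℚ < ε → ∃ λ N → ∀ n → N ℕ.≤ n →
    ∃ λ K → ∀ k → K ℕ.≤ k → ∣ seq (x n) k - ℓ k ∣ < ε
  converges {ε} ε>0 =
    let J₁ , h = small ε>0
        J₂ , c = ℓ-cauchy (½ * ε) (half ε>0)
        J = J₁ ℕ.⊔ J₂
    in M J , λ n ≤n →
      let K , g = near J n ≤n in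
      K ℕ.⊔ J , λ k ≤k → subst (∣ seq (x n) k - ℓ k ∣ <_) (halves ε)
        (∣p-r∣<ε {seq (x n) k} {ℓ J} {ℓ k}
          (ℚₚ.<-trans (g k (ℕₚ.m⊔n≤o⇒m≤o K J ≤k)) (h J (ℕₚ.m≤m⊔n J₁ J₂)))
          (c J k (ℕₚ.m≤n⊔m J₁ J₂)
            (ℕₚ.≤-trans (ℕₚ.m≤n⊔m J₁ J₂) (ℕₚ.m⊔n≤o⇒n≤o K J ≤k))))

∣p∣≤-from-square : ∀ {p s} → 0ℚ ≤ s → p * p ≤ s * s → ∣ p ∣ ≤ s
∣p∣≤-from-square {p} {s} s≥0 h = square-cancel-≤ s≥0 (subst (_≤ s * s)
  (trans (sym (ℚₚ.0≤p⇒∣p∣≡p (square-nonNeg p))) (ℚₚ.∣p*q∣≡∣p∣*∣q∣ p p)) h)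

≺⇒re : ∀ {z r} → z ≺ r → ∃ λ K → ∀ k → K ℕ.≤ k → ∣ seq (re z) k ∣ < r
≺⇒re {z} (mk≺ s s≥0 s<r N h) = N , λ k ≤k → ℚₚ.≤-<-trans
  (∣p∣≤-from-square s≥0 (ℚₚ.≤-trans (subst (_≤ seq ∣ z ∣² k) (ℚₚ.+-identityʳ _)
    (ℚₚ.+-monoʳ-≤ (seq (re z) k * seq (re z) k) (square-nonNeg (seq (im z) k)))) (h k ≤k))) s<r

≺⇒im : ∀ {z r} → z ≺ r → ∃ λ K → ∀ k → K ℕ.≤ k → ∣ seq (im z) k ∣ < r
≺⇒im {z} (mk≺ s s≥0 s<r N h) = N , λ k ≤k → ℚₚ.≤-<-trans
  (∣p∣≤-from-square s≥0 (ℚₚ.≤-trans (subst (_≤ seq ∣ z ∣² k) (ℚₚ.+-identityˡ _)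
    (ℚₚ.+-monoˡ-≤ (seq (im z) k * seq (im z) k) (square-nonNeg (seq (re z) k)))) (h k ≤k))) s<r

abstract
  ⇝-complete : ∀ {s} → (∀ ε → 0ℚ < ε → ∃ λ N → ∀ m n → N ℕ.≤ m → N ℕ.≤ n → s m ⊖ s n ≺ ε) →
               ∃ λ ℓ → s ⇝ ℓ
  ⇝-complete {s} s-cauchy = mkℂ Re.limit Im.limit , mk⇝ λ {ε} ε>0 →
    -- With each coordinate within ε/4, the sum of the two errors, which bounds the modulus, is ½ε
    -- and thus strictly below ε.
    let η>0 = half (half ε>0)
        M , g = Re.converges η>0
        N , h = Im.converges η>0
    in M ℕ.⊔ N , λ n ≤n →
      let K₁ , g′ = g n (ℕₚ.m⊔n≤o⇒m≤o M N ≤n)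
          K₂ , h′ = h n (ℕₚ.m⊔n≤o⇒n≤o M N ≤n)
      in mk≺ (½ * (½ * ε) + ½ * (½ * ε)) (ℚₚ.<⇒≤ (+-pos η>0 η>0))
        (subst (_< ε) (sym (halves (½ * ε))) (subst (½ * ε <_) (ℚₚ.*-identityˡ ε)
          (*-monoʳ-< ε>0 ½<1)))
        (K₁ ℕ.⊔ K₂) λ k ≤k → ∣∣²-≤ (s n ⊖ mkℂ Re.limit Im.limit) k
          (ℚₚ.<⇒≤ (g′ k (ℕₚ.m⊔n≤o⇒m≤o K₁ K₂ ≤k))) (ℚₚ.<⇒≤ (h′ k (ℕₚ.m⊔n≤o⇒n≤o K₁ K₂ ≤k)))
    where
    re-cauchy : Cauchyᴿ (λ n → re (s n))
    re-cauchy ε ε>0 = let N , h = s-cauchy ε ε>0 in N , λ m n ≤m ≤n → ≺⇒re (h m n ≤m ≤n)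
    im-cauchy : Cauchyᴿ (λ n → im (s n))
    im-cauchy ε ε>0 = let N , h = s-cauchy ε ε>0 in N , λ m n ≤m ≤n → ≺⇒im (h m n ≤m ≤n)
    module Re = Diagonal (λ n → re (s n)) re-cauchy
    module Im = Diagonal (λ n → im (s n)) im-cauchy

-- `approx√ n` falls short of the root by less than 1/(n+1). For large n one half of the gap γ
-- covers this rounding, and the other half keeps the radius 1 - γ/2 below 1.
<1⇒≺1 : ∀ {z} → ∣ z ∣ᶜ <ᴿ 1ᴿ → z ≺ 1ℚ
<1⇒≺1 {z} (mk< γ γ>0 N below) =
  let K , small = archimedean (½ * γ) (half γ>0) in
  mk≺ (1ℚ - ½ * γ)
    -- Nothing bounds γ directly; the radius is nonnegative because it dominates a nonnegative
    -- quantity at one late index.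
    (let n = N ℕ.⊔ K in ℚₚ.≤-trans
      (+-nonNeg (Approx.s≥0 n (D n)) (Approx.h≥0 n (D n)))
      (s+h≤ n (ℕₚ.m≤m⊔n N K) (ℚₚ.<⇒≤ (small n (ℕₚ.m≤n⊔m N K)))))
    (subst (1ℚ - ½ * γ <_) (ℚₚ.+-identityʳ 1ℚ) (ℚₚ.+-monoʳ-< 1ℚ (ℚₚ.neg-antimono-< (half γ>0))))
    (N ℕ.⊔ K) λ n ≤n →
      let s+h≥0 = +-nonNeg (Approx.s≥0 n (D n)) (Approx.h≥0 n (D n))
          le = s+h≤ n (ℕₚ.m⊔n≤o⇒m≤o N K ≤n) (ℚₚ.<⇒≤ (small n (ℕₚ.m⊔n≤o⇒n≤o N K ≤n)))
      in ℚₚ.≤-trans (p≤∣p∣ (D n)) (ℚₚ.≤-trans (ℚₚ.<⇒≤ (Approx.upper n (D n)))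
           (*-mono-≤ s+h≥0 s+h≥0 le le))
  where
  D : ℕ → ℚ
  D = seq ∣ z ∣²
  s+h≤ : ∀ n → N ℕ.≤ n → 1/suc n ≤ ½ * γ → approx√ n (D n) + 1/suc n ≤ 1ℚ - ½ * γ
  s+h≤ n ≤n h≤ = begin
    approx√ n (D n) + 1/suc n          ≤⟨ ℚₚ.+-monoʳ-≤ (approx√ n (D n)) h≤ ⟩
    approx√ n (D n) + ½ * γ            ≡⟨ solve 2 (λ s h → s :+ h := s :+ (h :+ h) :- h) refl
                                            (approx√ n (D n)) (½ * γ) ⟩
    approx√ n (D n) + (½ * γ + ½ * γ) - ½ * γ
                                       ≡⟨ cong (λ u → approx√ n (D n) + u - ½ * γ) (halves γ) ⟩
    approx√ n (D n) + γ - ½ * γ        ≤⟨ ℚₚ.+-monoˡ-≤ (- (½ * γ)) (below n ≤n) ⟩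
    1ℚ - ½ * γ                         ∎
    where
    open ℚₚ.≤-Reasoning
    open +-*-Solver

-- `approx√` rounds down, so this direction has no rounding error: closeness within half of the gap
-- g of ε leaves the other half as the gap of the conclusion.
⇝⇒⟶ : ∀ {s ℓ} → s ⇝ ℓ → s ⟶ ℓ
⇝⇒⟶ {s} {ℓ} s⇝ℓ ε (mk< g g>0 M above) =
  let N , h = ⇝⇒≺ s⇝ℓ (half g>0) in
  N , λ n ≤n →
    let mk≺ t t≥0 t<½g K close = h n ≤n
        D = λ k → seq ∣ s n ⊖ ℓ ∣² k
        root≤ : ∀ k → K ℕ.≤ k → approx√ k (D k) ≤ ½ * g
        root≤ k ≤k = ℚₚ.≤-trans (square-cancel-≤ t≥0 (ℚₚ.≤-trans (Approx.lower k (D k))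
          (subst (_≤ t * t) (sym (ℚₚ.0≤p⇒∣p∣≡p (∣∣²-nonNeg (s n ⊖ ℓ) k))) (close k ≤k))))
          (ℚₚ.<⇒≤ t<½g)
    in mk< (½ * g) (half g>0) (K ℕ.⊔ M) λ k ≤k →
      ℚₚ.≤-trans (ℚₚ.+-monoˡ-≤ (½ * g) (root≤ k (ℕₚ.m⊔n≤o⇒m≤o K M ≤k)))
        (subst (_≤ seq ε k) (trans (ℚₚ.+-identityˡ g) (sym (halves g)))
          (above k (ℕₚ.m⊔n≤o⇒n≤o K M ≤k)))

-- Geometrically bounded sequences and series

infixr 8 _^_
_^_ : ℚ → ℕ → ℚ
r ^ zero  = 1ℚ
r ^ suc n = r * r ^ n

^-pos : ∀ {r} → 0ℚ < r → ∀ n → 0ℚ < r ^ n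
^-pos r>0 zero    = 0<1
^-pos r>0 (suc n) = *-pos r>0 (^-pos r>0 n)

^-+ : ∀ r m n → r ^ (m ℕ.+ n) ≡ r ^ m * r ^ n
^-+ r zero    n = sym (ℚₚ.*-identityˡ (r ^ n))
^-+ r (suc m) n = trans (cong (r *_) (^-+ r m n)) (sym (ℚₚ.*-assoc r (r ^ m) (r ^ n)))

-- Bernoulli's inequality for 1/r ≥ 1 + (1 - r), multiplied by r ^ n.
bernoulli : ∀ {r} → 0ℚ < r → r < 1ℚ → ∀ n → r ^ n * (1ℚ + ι n * (1ℚ - r)) ≤ 1ℚ
bernoulli {r} r>0 r<1 zero = ℚₚ.≤-reflexive
  (solve 1 (λ h → con 1ℚ :* (con 1ℚ :+ con 0ℚ :* h) := con 1ℚ) refl (1ℚ - r))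
  where open +-*-Solver
bernoulli {r} r>0 r<1 (suc n) = begin
  r * r ^ n * (1ℚ + ι (suc n) * (1ℚ - r))
    ≡⟨ cong (λ u → r * r ^ n * (1ℚ + u * (1ℚ - r))) (ι-suc n) ⟩
  r * r ^ n * (1ℚ + (ι n + 1ℚ) * (1ℚ - r))
    ≤⟨ 0≤q-p⇒p≤q (subst (0ℚ ≤_) (difference r (r ^ n) (ι n))
         (*-nonNeg (ℚₚ.<⇒≤ (^-pos r>0 n)) (*-nonNeg (square-nonNeg (1ℚ - r))
           (+-nonNeg (ι-mono-≤ {0} {n} ℕ.z≤n) (ℚₚ.<⇒≤ 0<1))))) ⟩
  r ^ n * (1ℚ + ι n * (1ℚ - r))
    ≤⟨ bernoulli r>0 r<1 n ⟩
  1ℚ ∎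
  where
  open ℚₚ.≤-Reasoning
  open +-*-Solver
  difference : ∀ r p i → p * ((1ℚ - r) * (1ℚ - r) * (i + 1ℚ))
    ≡ p * (1ℚ + i * (1ℚ - r)) - r * p * (1ℚ + (i + 1ℚ) * (1ℚ - r))
  difference = solve 3 (λ r p i →
    p :* ((con 1ℚ :- r) :* (con 1ℚ :- r) :* (i :+ con 1ℚ))
      := p :* (con 1ℚ :+ i :* (con 1ℚ :- r))
           :- r :* p :* (con 1ℚ :+ (i :+ con 1ℚ) :* (con 1ℚ :- r))) refl

abstract
  -- By Bernoulli, r^n n (1 - r) ≤ 1 for n ≥ 1. If r^n ≥ ε, then 1/n ≥ (1 - r) ε, which fails for
  -- large n.
  ^-vanishes : ∀ {r ε} → 0ℚ < r → r < 1ℚ → 0ℚ < ε → ∃ λ N → ∀ n → N ℕ.≤ n → r ^ n < ε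
  ^-vanishes {r} {ε} r>0 r<1 ε>0 =
    let N , small = archimedean ((1ℚ - r) * ε) (*-pos h>0 ε>0)
    in suc N , λ { (suc n) (ℕ.s≤s N≤n) → ℚₚ.≰⇒> λ ε≤rⁿ →
      ℚₚ.<-irrefl refl (impossible n (small n N≤n) ε≤rⁿ) }
    where
    h>0 : 0ℚ < 1ℚ - r
    h>0 = p<q⇒0<q-p r<1
    open ℚₚ.≤-Reasoning
    open +-*-Solver
    impossible : ∀ n → 1/suc n < (1ℚ - r) * ε → ε ≤ r ^ suc n → 1ℚ < 1ℚ
    impossible n small ε≤rⁿ = begin-strict
      1ℚ
        ≡⟨ /-*-ι 1 n ⟨
      1/suc n * ι (suc n)
        <⟨ *-monoʳ-< (ι-suc>0 n) small ⟩
      (1ℚ - r) * ε * ι (suc n)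
        ≡⟨ solve 3 (λ h e i → h :* e :* i := e :* (i :* h)) refl (1ℚ - r) ε (ι (suc n)) ⟩
      ε * (ι (suc n) * (1ℚ - r))
        ≤⟨ *-monoʳ-≤ (ℚₚ.<⇒≤ (*-pos (ι-suc>0 n) h>0)) ε≤rⁿ ⟩
      r ^ suc n * (ι (suc n) * (1ℚ - r))
        ≤⟨ *-monoˡ-≤ (ℚₚ.<⇒≤ (^-pos r>0 (suc n))) (subst (_≤ 1ℚ + ι (suc n) * (1ℚ - r))
             (ℚₚ.+-identityˡ _) (ℚₚ.+-monoˡ-≤ (ι (suc n) * (1ℚ - r)) (ℚₚ.<⇒≤ 0<1))) ⟩
      r ^ suc n * (1ℚ + ι (suc n) * (1ℚ - r))
        ≤⟨ bernoulli r>0 r<1 (suc n) ⟩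
      1ℚ ∎

  *^-vanishes : ∀ {K r ε} → 0ℚ < K → 0ℚ < r → r < 1ℚ → 0ℚ < ε →
                ∃ λ N → ∀ n → N ℕ.≤ n → K * r ^ n < ε
  *^-vanishes {K} {r} {ε} K>0 r>0 r<1 ε>0 =
    let N , h = ^-vanishes {r} {inv K>0 * ε} r>0 r<1 (*-pos (inv-pos K>0) ε>0)
    in N , λ n ≤n → subst (K * r ^ n <_) (*-inv-cancel K>0 ε) (*-monoˡ-< K>0 (h n ≤n))

record Geometric (f : ℕ → ℂ) (ρ : ℚ) : Set where
  constructor geometric
  field
    {factor} : ℚ
    factor>0 : 0ℚ < factor
    bound    : ∀ k → f k ≺ factor * ρ ^ k

vanishing : ∀ {s ℓ K r} → 0ℚ < K → 0ℚ < r → r < 1ℚ → (∀ n → s n ⊖ ℓ ≺ K * r ^ n) → s ⇝ ℓ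
vanishing K>0 r>0 r<1 h = mk⇝ λ ε>0 →
  let N , small = *^-vanishes K>0 r>0 r<1 ε>0 in
  N , λ n ≤n → ≺-mono (ℚₚ.<⇒≤ (small n ≤n)) (h n)

Geometric⇒⇝0 : ∀ {f ρ} → 0ℚ < ρ → ρ < 1ℚ → Geometric f ρ → f ⇝ 0ᶜ
Geometric⇒⇝0 {f} ρ>0 ρ<1 (geometric K>0 h) = vanishing K>0 ρ>0 ρ<1 λ n →
  ≺-resp-≈ (solve 1 (λ z → z := z :- con 0ℚ) ≈-refl (f n)) (h n)
  where open ℂ-Solver

-- Only the first N ratios are uncontrolled, and dropping the first term lowers N by one. A bound L
-- ρ^k on the shifted tail reads (L/ρ) ρ^(k+1) at the original index, whence the factor K + L/ρ.
Geometric-by-ratios : ∀ {ρ} → 0ℚ < ρ → ∀ N {f g : ℕ → ℂ} → (∀ k → f (suc k) ≈ f k *ᶜ g k) →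
                      (∀ k → N ℕ.≤ k → g k ≺ ρ) → Geometric f ρ
Geometric-by-ratios {ρ} ρ>0 zero {f} {g} step g≺ρ =
  let K , f₀≺K = ≺-finite (f 0) in geometric (≺-pos f₀≺K) (bound f₀≺K)
  where
  open +-*-Solver
  bound : ∀ {K} → f 0 ≺ K → ∀ k → f k ≺ K * ρ ^ k
  bound {K} f₀≺K zero    = subst (f 0 ≺_) (sym (ℚₚ.*-identityʳ K)) f₀≺K
  bound {K} f₀≺K (suc k) = ≺-resp-≈ (≈-sym (step k))
    (subst (f k *ᶜ g k ≺_)
      (solve 3 (λ K p r → K :* p :* r := K :* (r :* p)) refl K (ρ ^ k) ρ)
      (≺-* (bound f₀≺K k) (g≺ρ k ℕ.z≤n)))
Geometric-by-ratios {ρ} ρ>0 (suc N) {f} {g} step g≺ρ =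
  let K , f₀≺K = ≺-finite (f 0)
      geometric {L} L>0 tail = Geometric-by-ratios ρ>0 N {λ k → f (suc k)} {λ k → g (suc k)}
        (λ k → step (suc k)) (λ k N≤k → g≺ρ (suc k) (ℕ.s≤s N≤k))
      K>0 = ≺-pos f₀≺K
      L′>0 = *-pos (inv-pos ρ>0) L>0
  in geometric (+-pos K>0 L′>0) λ
    { zero → ≺-mono (lemma₀ K>0 L′>0) f₀≺K
    ; (suc k) → ≺-mono (lemma₁ k K>0 {L}) (tail k) }
  where
  open ℚₚ.≤-Reasoning
  open +-*-Solver
  lemma₀ : ∀ {K L} → 0ℚ < K → 0ℚ < L → K ≤ (K + L) * 1ℚ
  lemma₀ {K} {L} K>0 L>0 = subst₂ _≤_ (ℚₚ.+-identityʳ K) (sym (ℚₚ.*-identityʳ (K + L)))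
    (ℚₚ.+-monoʳ-≤ K (ℚₚ.<⇒≤ L>0))
  lemma₁ : ∀ {K} k → 0ℚ < K → ∀ {L} → L * ρ ^ k ≤ (K + inv ρ>0 * L) * (ρ * ρ ^ k)
  lemma₁ {K} k K>0 {L} = begin
    L * ρ ^ k                                  ≡⟨ ℚₚ.+-identityˡ (L * ρ ^ k) ⟨
    0ℚ + L * ρ ^ k                             ≤⟨ ℚₚ.+-monoˡ-≤ (L * ρ ^ k)
                                                    (ℚₚ.<⇒≤ (*-pos K>0 (*-pos ρ>0 (^-pos ρ>0 k)))) ⟩
    K * (ρ * ρ ^ k) + L * ρ ^ k                ≡⟨ cong (λ u → K * (ρ * ρ ^ k) + u * ρ ^ k)
                                                    (*-inv-cancel ρ>0 L) ⟨
    K * (ρ * ρ ^ k) + ρ * (inv ρ>0 * L) * ρ ^ k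
      ≡⟨ solve 4 (λ K r p m → K :* (r :* p) :+ r :* m :* p := (K :+ m) :* (r :* p)) refl
           K ρ (ρ ^ k) (inv ρ>0 * L) ⟩
    (K + inv ρ>0 * L) * (ρ * ρ ^ k)            ∎

ratio-test : ∀ {f g : ℕ → ℂ} {γ ρ} → (∀ k → f (suc k) ≈ f k *ᶜ g k) → g ⇝ γ → γ ≺ ρ → Geometric f ρ
ratio-test {f} {g} step g⇝γ γ≺ρ = let N , h = ⇝-eventually-≺ g⇝γ γ≺ρ in
  Geometric-by-ratios (≺-pos γ≺ρ) N {f} {g} step h

Σ<-cong : ∀ n {f g} → (∀ k → k ℕ.< n → f k ≈ g k) → Σ< n f ≈ Σ< n g
Σ<-cong zero    f≈g = ≈-refl
Σ<-cong (suc n) f≈g =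
  +ᶜ-cong (Σ<-cong n λ k k<n → f≈g k (ℕₚ.m≤n⇒m≤1+n k<n)) (f≈g n ℕₚ.≤-refl)

Σ<-++ : ∀ m n f → Σ< (m ℕ.+ n) f ≈ Σ< m f +ᶜ Σ< n (λ k → f (m ℕ.+ k))
Σ<-++ m zero f rewrite ℕₚ.+-identityʳ m =
  solve 1 (λ z → z := z :+ con 0ℚ) ≈-refl (Σ< m f)
  where open ℂ-Solver
Σ<-++ m (suc n) f rewrite ℕₚ.+-suc m n = ≈-trans (+ᶜ-cong (Σ<-++ m n f) ≈-refl)
  (solve 3 (λ a b c → a :+ b :+ c := a :+ (b :+ c)) ≈-refl
    (Σ< m f) (Σ< n (λ k → f (m ℕ.+ k))) (f (m ℕ.+ n)))
  where open ℂ-Solver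

Σ<-+ : ∀ n f g → Σ< n (λ k → f k +ᶜ g k) ≈ Σ< n f +ᶜ Σ< n g
Σ<-+ zero    f g = solve 0 (con 0ℚ := con 0ℚ :+ con 0ℚ) ≈-refl
  where open ℂ-Solver
Σ<-+ (suc n) f g = ≈-trans (+ᶜ-cong (Σ<-+ n f g) ≈-refl)
  (solve 4 (λ a b c d → a :+ b :+ (c :+ d) := a :+ c :+ (b :+ d)) ≈-refl
    (Σ< n f) (Σ< n g) (f n) (g n))
  where open ℂ-Solver

Σ<-*ʳ : ∀ n f z → Σ< n (λ k → f k *ᶜ z) ≈ Σ< n f *ᶜ z
Σ<-*ʳ zero    f z = solve 1 (λ z → con 0ℚ := con 0ℚ :* z) ≈-refl z
  where open ℂ-Solver
Σ<-*ʳ (suc n) f z = ≈-trans (+ᶜ-cong (Σ<-*ʳ n f z) ≈-refl)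
  (solve 3 (λ a b z → a :* z :+ b :* z := (a :+ b) :* z) ≈-refl (Σ< n f) (f n) z)
  where open ℂ-Solver

-- The bound c (2 - ρⁿ) is what makes the induction go through; it is positive already
-- for the empty sum.
Σ<-geometric : ∀ {ρ c} → 0ℚ < ρ → 0ℚ < c → ∀ n {f} →
               (∀ k → k ℕ.< n → f k ≺ c * (1ℚ - ρ) * ρ ^ k) → Σ< n f ≺ c + c
Σ<-geometric {ρ} {c} ρ>0 c>0 n {f} h = ≺-mono le (sharp n h)
  where
  open +-*-Solver
  sharp : ∀ n → (∀ k → k ℕ.< n → f k ≺ c * (1ℚ - ρ) * ρ ^ k) → Σ< n f ≺ c * (1ℚ + (1ℚ - ρ ^ n))
  sharp zero    h = 0≺ (subst (0ℚ <_)
    (solve 1 (λ c → c := c :* (con 1ℚ :+ (con 1ℚ :- con 1ℚ))) refl c) c>0)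
  sharp (suc n) h = subst (Σ< (suc n) f ≺_)
    (solve 3 (λ c p r → c :* (con 1ℚ :+ (con 1ℚ :- p)) :+ c :* (con 1ℚ :- r) :* p
      := c :* (con 1ℚ :+ (con 1ℚ :- r :* p))) refl c (ρ ^ n) ρ)
    (≺-+ (sharp n λ k k<n → h k (ℕₚ.m≤n⇒m≤1+n k<n)) (h n ℕₚ.≤-refl))
  le : c * (1ℚ + (1ℚ - ρ ^ n)) ≤ c + c
  le = 0≤q-p⇒p≤q (subst (0ℚ ≤_)
    (solve 2 (λ c p → c :* p := c :+ c :- c :* (con 1ℚ :+ (con 1ℚ :- p))) refl c (ρ ^ n))
    (ℚₚ.<⇒≤ (*-pos c>0 (^-pos ρ>0 n))))

-- The rate of the remainder is recorded along with the limit because the Cauchy product relies on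
-- it.
record Sum (f : ℕ → ℂ) (ρ : ℚ) : Set where
  constructor mkSum
  field
    sum       : ℂ
    converges : (λ n → Σ< n f) ⇝ sum
    remainder : Geometric (λ n → sum ⊖ Σ< n f) ρ

abstract
  geometric-sum : ∀ {f ρ} → 0ℚ < ρ → ρ < 1ℚ → Geometric f ρ → Sum f ρ
  geometric-sum {f} {ρ} ρ>0 ρ<1 (geometric {K} K>0 h) =
    let S , ⇝S = ⇝-complete s-cauchy in
    mkSum S ⇝S (geometric (+-pos (+-pos c>0 c>0) 0<1) λ n →
      ⇝-limit-≺ (⇝-+ ⇝S (⇝-neg (⇝-const (Σ< n f)))) (n , λ m n≤m → tail n m n≤m)
        (*-monoʳ-< (^-pos ρ>0 n) (p<p+1 (c + c))))
    where
    open +-*-Solver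
    module C = ℂ-Solver
    1-ρ>0 : 0ℚ < 1ℚ - ρ
    1-ρ>0 = p<q⇒0<q-p ρ<1
    -- K/(1 - ρ) is the sum of the dominating series; it brings K ρ^k into the form c (1 - ρ) ρ^k
    -- that `Σ<-geometric` expects.
    c : ℚ
    c = inv 1-ρ>0 * K
    c>0 : 0ℚ < c
    c>0 = *-pos (inv-pos 1-ρ>0) K>0
    rescale : ∀ n k → K * ρ ^ (n ℕ.+ k) ≡ c * ρ ^ n * (1ℚ - ρ) * ρ ^ k
    rescale n k = trans
      (cong₂ _*_ (sym (*-inv-cancel 1-ρ>0 K)) (^-+ ρ n k))
      (solve 4 (λ h c p q → h :* c :* (p :* q) := c :* p :* h :* q) refl (1ℚ - ρ) c (ρ ^ n) (ρ ^ k))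
    tail : ∀ n m → n ℕ.≤ m → Σ< m f ⊖ Σ< n f ≺ (c + c) * ρ ^ n
    tail n m n≤m = subst (λ m → Σ< m f ⊖ Σ< n f ≺ (c + c) * ρ ^ n) (ℕₚ.m+[n∸m]≡n n≤m)
      (≺-resp-≈ (≈-trans
          (C.solve 2 (λ a b → b C.:= (a C.:+ b) C.:- a) ≈-refl (Σ< n f)
            (Σ< (m ∸ n) (λ k → f (n ℕ.+ k))))
          (+ᶜ-cong (≈-sym (Σ<-++ n (m ∸ n) f)) ≈-refl))
        (subst (Σ< (m ∸ n) (λ k → f (n ℕ.+ k)) ≺_) (sym (ℚₚ.*-distribʳ-+ (ρ ^ n) c c))
          (Σ<-geometric ρ>0 (*-pos c>0 (^-pos ρ>0 n)) (m ∸ n) λ k _ →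
            subst (f (n ℕ.+ k) ≺_) (rescale n k) (h (n ℕ.+ k)))))
    s-cauchy : ∀ ε → 0ℚ < ε → ∃ λ N → ∀ m n → N ℕ.≤ m → N ℕ.≤ n → Σ< m f ⊖ Σ< n f ≺ ε
    s-cauchy ε ε>0 =
      let N , small = *^-vanishes (+-pos c>0 c>0) ρ>0 ρ<1 (half ε>0)
          le = ℚₚ.<⇒≤ (small N ℕₚ.≤-refl)
      in N , λ m n N≤m N≤n → ≺-resp-≈
        (C.solve 3 (λ a b c → (a C.:- c) C.:+ (C.:- (b C.:- c)) C.:= a C.:- b) ≈-refl
          (Σ< m f) (Σ< n f) (Σ< N f))
        (≺-halves (≺-mono le (tail N m N≤m)) (≺-neg (≺-mono le (tail N n N≤n))))

-- The q-binomial theorem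

inverse-unique : ∀ {z u v} → z *ᶜ u ≈ 1ᶜ → z *ᶜ v ≈ 1ᶜ → u ≈ v
inverse-unique {z} {u} {v} zu≈1 zv≈1 = ≈-trans
  (solve 1 (λ u → u := u :* con 1ℚ) ≈-refl u)
  (≈-trans (*ᶜ-cong ≈-refl (≈-sym zv≈1))
  (≈-trans (solve 3 (λ z u v → u :* (z :* v) := (z :* u) :* v) ≈-refl z u v)
  (≈-trans (*ᶜ-cong zu≈1 ≈-refl) (*ᶜ-identityˡ v))))
  where open ℂ-Solver

^ᶜ-distrib-* : ∀ z w n → (z *ᶜ w) ^ᶜ n ≈ z ^ᶜ n *ᶜ w ^ᶜ n
^ᶜ-distrib-* z w zero    = solve 0 (con 1ℚ := con 1ℚ :* con 1ℚ) ≈-refl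
  where open ℂ-Solver
^ᶜ-distrib-* z w (suc n) = ≈-trans (*ᶜ-cong ≈-refl (^ᶜ-distrib-* z w n))
  (solve 4 (λ z w a b → z :* w :* (a :* b) := z :* a :* (w :* b)) ≈-refl z w (z ^ᶜ n) (w ^ᶜ n))
  where open ℂ-Solver

^ᶜ-geometric : ∀ {z r} a → z ≺ r → Geometric (λ k → z ^ᶜ k *ᶜ a) r
^ᶜ-geometric {z} a z≺r = ratio-test
  (λ k → solve 3 (λ z p a → z :* p :* a := p :* a :* z) ≈-refl z (z ^ᶜ k) a) (⇝-const z) z≺r
  where open ℂ-Solver

module QSeries (q : ℂ) (r : ℚ) (r>0 : 0ℚ < r) (r<1 : r < 1ℚ) (q≺r : q ≺ r) where

  q≺1 : q ≺ 1ℚ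
  q≺1 = ≺-mono (ℚₚ.<⇒≤ r<1) q≺r

  qᵏa⇝0 : ∀ a → (λ k → q ^ᶜ k *ᶜ a) ⇝ 0ᶜ
  qᵏa⇝0 a = Geometric⇒⇝0 r>0 r<1 (^ᶜ-geometric a q≺r)

  q^⇝0 : (λ k → q ^ᶜ k) ⇝ 0ᶜ
  q^⇝0 = ⇝-cong (λ k → solve 1 (λ z → z :* con 1ℚ := z) ≈-refl (q ^ᶜ k)) ≈-refl (qᵏa⇝0 1ᶜ)
    where open ℂ-Solver

  qFactor≈ : ∀ a k → qFactor a q k ≈ 1ᶜ ⊖ q ^ᶜ k *ᶜ a
  qFactor≈ a k = -ᶜ≈⊖ 1ᶜ (q ^ᶜ k *ᶜ a)

  qFactor⇝1 : ∀ a → qFactor a q ⇝ 1ᶜ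
  qFactor⇝1 a = ⇝-cong (λ k → ≈-sym (qFactor≈ a k))
    (solve 0 (con 1ℚ :- con 0ℚ := con 1ℚ) ≈-refl)
    (⇝-+ (⇝-const 1ᶜ) (⇝-neg (qᵏa⇝0 a)))
    where open ℂ-Solver

  -- The partial products telescope as 1 + Σ dₖ with dₖ = -(a;q)ₖ qᵏ a, and dₖ₊₁ / dₖ → q.
  qPochhammer-converges : ∀ a → ∃ λ P → qPochhammer a q ⇝ P
  qPochhammer-converges a =
    let mkSum S ⇝S _ = geometric-sum r>0 r<1 (ratio-test step ratio⇝q q≺r)
    in 1ᶜ +ᶜ S , ⇝-cong telescope ≈-refl (⇝-+ (⇝-const 1ᶜ) ⇝S)
    where
    open ℂ-Solver
    P = qPochhammer a q
    d ratio : ℕ → ℂ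
    d k = negᶜ (P k *ᶜ (q ^ᶜ k *ᶜ a))
    ratio k = qFactor a q k *ᶜ q
    step : ∀ k → d (suc k) ≈ d k *ᶜ ratio k
    step k = solve 5 (λ p f q s a →
      :- (p :* f :* (q :* s :* a)) := :- (p :* (s :* a)) :* (f :* q)) ≈-refl
      (P k) (qFactor a q k) q (q ^ᶜ k) a
    ratio⇝q : ratio ⇝ q
    ratio⇝q = ⇝-cong (λ _ → ≈-refl) (*ᶜ-identityˡ q) (⇝-* (qFactor⇝1 a) (⇝-const q))
    telescope : ∀ n → 1ᶜ +ᶜ Σ< n d ≈ P n
    telescope zero    = solve 0 (con 1ℚ :+ con 0ℚ := con 1ℚ) ≈-refl
    telescope (suc n) = ≈-trans
      (solve 3 (λ s p x → con 1ℚ :+ (s :+ :- (p :* x)) := (con 1ℚ :+ s) :- p :* x) ≈-refl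
        (Σ< n d) (P n) (q ^ᶜ n *ᶜ a))
      (≈-trans (+ᶜ-cong (telescope n) ≈-refl)
      (≈-trans (solve 2 (λ p x → p :- p :* x := p :* (con 1ℚ :- x)) ≈-refl (P n) (q ^ᶜ n *ᶜ a))
        (*ᶜ-cong ≈-refl (≈-sym (qFactor≈ a n)))))

  r*p≤p : ∀ {p} → 0ℚ < p → r * p ≤ p
  r*p≤p {p} p>0 = subst (r * p ≤_) (ℚₚ.*-identityˡ p) (*-monoʳ-≤ (ℚₚ.<⇒≤ p>0) (ℚₚ.<⇒≤ r<1))

  -- The exponent starts at 1, as q^0 = 1 is not below r. The bound is uniform in k, and so is the
  -- resulting bound on the inverses of the factors 1 - q^(k+1).
  q^suc≺r : ∀ k → q ^ᶜ suc k ≺ r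
  q^suc≺r zero    = ≺-resp-≈ (solve 1 (λ q → q := q :* con 1ℚ) ≈-refl q) q≺r
    where open ℂ-Solver
  q^suc≺r (suc k) = ≺-mono (r*p≤p r>0) (≺-* q≺r (q^suc≺r k))

  qᵏq≺r : ∀ k → q ^ᶜ k *ᶜ q ≺ r
  qᵏq≺r k = ≺-resp-≈ (*ᶜ-comm q (q ^ᶜ k)) (q^suc≺r k)

  qFactor≠ : ∀ k → NonZeroᶜ (qFactor q q k)
  qFactor≠ k = nonZero-1- (qᵏq≺r k) r<1

  q≠ : ∀ m → NonZeroᶜ (qPochhammer q q m)
  q≠ zero    = unit⇒nonZero {1ᶜ} {1ᶜ} (*ᶜ-identityˡ 1ᶜ)
  q≠ (suc m) = *-nonZeroᶜ (qPochhammer q q m) (qFactor q q m) (q≠ m) (qFactor≠ m)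

  invFactor invPochhammer : ℕ → ℂ
  invFactor k = invᶜ (qFactor q q k) (qFactor≠ k)
  invPochhammer k = invᶜ (qPochhammer q q k) (q≠ k)

  factor*inv : ∀ k → (1ᶜ ⊖ q ^ᶜ k *ᶜ q) *ᶜ invFactor k ≈ 1ᶜ
  factor*inv k = ≈-trans (*ᶜ-cong (≈-sym (qFactor≈ q k)) ≈-refl)
    (*ᶜ-inverseʳ (qFactor q q k) (qFactor≠ k))

  -- With d = q^(k+1) and w = 1/(1 - d) one has w - 1 = w d, where w stays below the common bound W
  -- and d decays geometrically.
  invFactor⇝1 : invFactor ⇝ 1ᶜ
  invFactor⇝1 =
    let geometric {K} K>0 h = ^ᶜ-geometric q q≺r
        w≺W = λ k → invᶜ-1-≺ (qᵏq≺r k) r<1 (qFactor≠ k)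
        W = inv (p<q⇒0<q-p r<1) + 1ℚ
    in vanishing (*-pos (≺-pos (w≺W 0)) K>0) r>0 r<1 λ k →
      ≺-resp-≈ (difference k)
        (subst (invFactor k *ᶜ (q ^ᶜ k *ᶜ q) ≺_) (sym (ℚₚ.*-assoc W K (r ^ k)))
          (≺-* (w≺W k) (h k)))
    where
    open ℂ-Solver
    difference : ∀ k → invFactor k *ᶜ (q ^ᶜ k *ᶜ q) ≈ invFactor k ⊖ 1ᶜ
    difference k = ≈-trans
      (solve 2 (λ w d → w :* d := w :- (con 1ℚ :- d) :* w) ≈-refl (invFactor k) (q ^ᶜ k *ᶜ q))
      (+ᶜ-cong ≈-refl (negᶜ-cong (factor*inv k)))

  invPochhammer-zero : invPochhammer 0 ≈ 1ᶜ
  invPochhammer-zero = ≈-trans (≈-sym (*ᶜ-identityˡ (invPochhammer 0))) (*ᶜ-inverseʳ 1ᶜ (q≠ 0))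

  invPochhammer-suc : ∀ k → invPochhammer (suc k) ≈ invPochhammer k *ᶜ invFactor k
  invPochhammer-suc k = inverse-unique (*ᶜ-inverseʳ (qPochhammer q q (suc k)) (q≠ (suc k)))
    (≈-trans (solve 4 (λ p f u v → p :* f :* (u :* v) := (p :* u) :* (f :* v)) ≈-refl
        (qPochhammer q q k) (qFactor q q k) (invPochhammer k) (invFactor k))
    (≈-trans (*ᶜ-cong (*ᶜ-inverseʳ (qPochhammer q q k) (q≠ k))
                      (*ᶜ-inverseʳ (qFactor q q k) (qFactor≠ k)))
      (*ᶜ-identityˡ 1ᶜ)))
    where open ℂ-Solver

  module Heine (α : ℂ) where

    term : ℂ → ℕ → ℂ
    term z k = qPochhammer α q k *ᶜ z ^ᶜ k *ᶜ invPochhammer k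

    ratio : ℂ → ℕ → ℂ
    ratio z k = z *ᶜ (qFactor α q k *ᶜ invFactor k)

    term-suc : ∀ z k → term z (suc k) ≈ term z k *ᶜ ratio z k
    term-suc z k = ≈-trans (*ᶜ-cong ≈-refl (invPochhammer-suc k))
      (solve 6 (λ p f z s u v → p :* f :* (z :* s) :* (u :* v)
        := p :* s :* u :* (z :* (f :* v))) ≈-refl
        (qPochhammer α q k) (qFactor α q k) z (z ^ᶜ k) (invPochhammer k) (invFactor k))
      where open ℂ-Solver

    ratio⇝z : ∀ z → ratio z ⇝ z
    ratio⇝z z = ⇝-cong (λ _ → ≈-refl)
      (solve 1 (λ z → z :* (con 1ℚ :* con 1ℚ) := z) ≈-refl z)
      (⇝-* (⇝-const z) (⇝-* (qFactor⇝1 α) invFactor⇝1))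
      where open ℂ-Solver

    term-geometric : ∀ {z ρ} → z ≺ ρ → Geometric (term z) ρ
    term-geometric {z} = ratio-test (term-suc z) (ratio⇝z z)

    term-zero : ∀ z → term z 0 ≈ 1ᶜ
    term-zero z = ≈-trans (*ᶜ-cong ≈-refl invPochhammer-zero)
      (solve 0 (con 1ℚ :* con 1ℚ :* con 1ℚ := con 1ℚ) ≈-refl)
      where open ℂ-Solver

    term-q* : ∀ z k → term (q *ᶜ z) k ≈ q ^ᶜ k *ᶜ term z k
    term-q* z k = ≈-trans (*ᶜ-cong (*ᶜ-cong ≈-refl (^ᶜ-distrib-* q z k)) ≈-refl)
      (solve 4 (λ p a s u → p :* (a :* s) :* u := a :* (p :* s :* u)) ≈-refl
        (qPochhammer α q k) (q ^ᶜ k) (z ^ᶜ k) (invPochhammer k))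
      where open ℂ-Solver

    abstract
      series : ∀ {z} → z ≺ 1ℚ → ∃ λ S → (λ n → Σ< n (term z)) ⇝ S
      series z≺1 =
        let ρ , ρ>0 , ρ<1 , z≺ρ = ≺-open z≺1
            mkSum S ⇝S _ = geometric-sum ρ>0 ρ<1 (term-geometric z≺ρ)
        in S , ⇝S

    φ : ∀ {z} → z ≺ 1ℚ → ℂ
    φ z≺1 = proj₁ (series z≺1)

    term⇝0 : ∀ {z} → z ≺ 1ℚ → term z ⇝ 0ᶜ
    term⇝0 z≺1 = let ρ , ρ>0 , ρ<1 , z≺ρ = ≺-open z≺1 in
      Geometric⇒⇝0 ρ>0 ρ<1 (term-geometric z≺ρ)

    term-recurrence : ∀ z k →
      term z (suc k) *ᶜ (1ᶜ ⊖ q ^ᶜ suc k) ≈ term z k *ᶜ z *ᶜ (1ᶜ ⊖ q ^ᶜ k *ᶜ α)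
    term-recurrence z k = ≈-trans (*ᶜ-cong (term-suc z k) ≈-refl)
      (≈-trans (solve 6 (λ t z f w q s → t :* (z :* (f :* w)) :* (con 1ℚ :- q :* s)
          := t :* z :* f :* ((con 1ℚ :- s :* q) :* w)) ≈-refl
          (term z k) z (qFactor α q k) (invFactor k) q (q ^ᶜ k))
      (≈-trans (*ᶜ-cong (*ᶜ-cong ≈-refl (qFactor≈ α k)) (factor*inv k))
        (solve 1 (λ x → x :* con 1ℚ := x) ≈-refl (term z k *ᶜ z *ᶜ (1ᶜ ⊖ q ^ᶜ k *ᶜ α)))))
      where open ℂ-Solver

    -- Truncating the functional equation leaves a single boundary term, which tends to 0 with
    -- `term z n`. It vanishes at n = 0 through 1 - q^0, and `term-recurrence` carries it from n to
    -- n + 1.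
    partial-functional : ∀ z n → (1ᶜ ⊖ z) *ᶜ Σ< n (term z)
      ≈ (1ᶜ ⊖ α *ᶜ z) *ᶜ Σ< n (term (q *ᶜ z)) ⊖ term z n *ᶜ (1ᶜ ⊖ q ^ᶜ n)
    partial-functional z zero =
      solve 3 (λ z α t → (con 1ℚ :- z) :* con 0ℚ
        := (con 1ℚ :- α :* z) :* con 0ℚ :- t :* (con 1ℚ :- con 1ℚ)) ≈-refl z α (term z 0)
      where open ℂ-Solver
    partial-functional z (suc n) =
      ≈-trans (solve 3 (λ z s t → (con 1ℚ :- z) :* (s :+ t)
          := (con 1ℚ :- z) :* s :+ (con 1ℚ :- z) :* t) ≈-refl z (Σ< n (term z)) (term z n))
      (≈-trans (+ᶜ-cong (partial-functional z n) ≈-refl)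
      (≈-trans (solve 5 (λ z α s t p →
          (con 1ℚ :- α :* z) :* s :- t :* (con 1ℚ :- p) :+ (con 1ℚ :- z) :* t
            := (con 1ℚ :- α :* z) :* (s :+ p :* t) :- t :* z :* (con 1ℚ :- p :* α)) ≈-refl
          z α (Σ< n (term (q *ᶜ z))) (term z n) (q ^ᶜ n))
        (+ᶜ-cong (*ᶜ-cong ≈-refl (+ᶜ-cong ≈-refl (≈-sym (term-q* z n))))
          (negᶜ-cong (≈-sym (term-recurrence z n))))))
      where open ℂ-Solver

    functional : ∀ {z} (z≺1 : z ≺ 1ℚ) (qz≺1 : q *ᶜ z ≺ 1ℚ) →
                 (1ᶜ ⊖ z) *ᶜ φ z≺1 ≈ (1ᶜ ⊖ α *ᶜ z) *ᶜ φ qz≺1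
    functional {z} z≺1 qz≺1 = ⇝-unique
      (⇝-* (⇝-const (1ᶜ ⊖ z)) (proj₂ (series z≺1)))
      (⇝-cong (λ n → ≈-sym (partial-functional z n))
        (solve 1 (λ x → x :- con 0ℚ :* (con 1ℚ :- con 0ℚ) := x) ≈-refl
          ((1ᶜ ⊖ α *ᶜ z) *ᶜ φ qz≺1))
        (⇝-+ (⇝-* (⇝-const (1ᶜ ⊖ α *ᶜ z)) (proj₂ (series qz≺1)))
          (⇝-neg (⇝-* (term⇝0 z≺1) (⇝-+ (⇝-const 1ᶜ) (⇝-neg q^⇝0))))))
      where open ℂ-Solver

    module Iterate (z : ℂ) (z≺1 : z ≺ 1ℚ) where

      -- Each value is literally q times the previous one, as on the right of `functional`. Since
      -- `φ` takes a size bound for its very argument, q^n z, which agrees with `shift n` only up to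
      -- `≈`, would not fit.
      shift : ℕ → ℂ
      shift zero    = z
      shift (suc n) = q *ᶜ shift n

      shift≈ : ∀ n → shift n ≈ q ^ᶜ n *ᶜ z
      shift≈ zero    = ≈-sym (*ᶜ-identityˡ z)
      shift≈ (suc n) = ≈-trans (*ᶜ-cong ≈-refl (shift≈ n)) (≈-sym (*ᶜ-assoc q (q ^ᶜ n) z))

      shift≺1 : ∀ n → shift n ≺ 1ℚ
      shift≺1 zero    = z≺1
      shift≺1 (suc n) = subst (q *ᶜ shift n ≺_) (ℚₚ.*-identityˡ 1ℚ) (≺-* q≺1 (shift≺1 n))

      step : ∀ n → qFactor z q n *ᶜ φ (shift≺1 n) ≈ qFactor (α *ᶜ z) q n *ᶜ φ (shift≺1 (suc n))
      step n = ≈-trans (*ᶜ-cong factor≈ ≈-refl)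
        (≈-trans (functional (shift≺1 n) (shift≺1 (suc n))) (*ᶜ-cong (≈-sym α-factor≈) ≈-refl))
        where
        open ℂ-Solver
        factor≈ : qFactor z q n ≈ 1ᶜ ⊖ shift n
        factor≈ = ≈-trans (qFactor≈ z n) (+ᶜ-cong ≈-refl (negᶜ-cong (≈-sym (shift≈ n))))
        α-factor≈ : qFactor (α *ᶜ z) q n ≈ 1ᶜ ⊖ α *ᶜ shift n
        α-factor≈ = ≈-trans (qFactor≈ (α *ᶜ z) n) (+ᶜ-cong ≈-refl (negᶜ-cong (≈-trans
          (solve 3 (λ s a z → s :* (a :* z) := a :* (s :* z)) ≈-refl (q ^ᶜ n) α z)
          (*ᶜ-cong ≈-refl (≈-sym (shift≈ n))))))

      iterated : ∀ n → qPochhammer z q n *ᶜ φ z≺1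
                     ≈ qPochhammer (α *ᶜ z) q n *ᶜ φ (shift≺1 n)
      iterated zero    = ≈-refl
      iterated (suc n) = exchange (iterated n) (step n)
        where
        open ℂ-Solver
        exchange : ∀ {p f x p′ y f′ y′} → p *ᶜ x ≈ p′ *ᶜ y → f *ᶜ y ≈ f′ *ᶜ y′ →
                   (p *ᶜ f) *ᶜ x ≈ (p′ *ᶜ f′) *ᶜ y′
        exchange {p} {f} {x} {p′} {y} {f′} {y′} px≈ fy≈ =
          ≈-trans (solve 3 (λ p f x → p :* f :* x := f :* (p :* x)) ≈-refl p f x)
          (≈-trans (*ᶜ-cong ≈-refl px≈)
          (≈-trans (solve 3 (λ p f x → f :* (p :* x) := p :* (f :* x)) ≈-refl p′ f y)
          (≈-trans (*ᶜ-cong ≈-refl fy≈)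
            (solve 3 (λ p f x → p :* (f :* x) := p :* f :* x) ≈-refl p′ f′ y′))))

      module Tail {ρ K} (ρ>0 : 0ℚ < ρ) (ρ<1 : ρ < 1ℚ) (K>0 : 0ℚ < K)
                  (h : ∀ k → term z k ≺ K * ρ ^ k) where

        -- Passing from z to qz multiplies the term of index k + 1 by q^(k+1), of modulus below r.
        -- Only the constant term is left unchanged, which is why φ_α(q^n z) tends to 1.
        term-suc≺ : ∀ n k → term (shift n) (suc k) ≺ r ^ n * (K * ρ ^ suc k)
        term-suc≺ zero    k = subst (term z (suc k) ≺_) (sym (ℚₚ.*-identityˡ _)) (h (suc k))
        term-suc≺ (suc n) k = ≺-resp-≈ (≈-sym (term-q* (shift n) (suc k)))
          (subst (q ^ᶜ suc k *ᶜ term (shift n) (suc k) ≺_)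
            (sym (ℚₚ.*-assoc r (r ^ n) (K * ρ ^ suc k)))
            (≺-* (q^suc≺r k) (term-suc≺ n k)))

        1-ρ>0 : 0ℚ < 1ℚ - ρ
        1-ρ>0 = p<q⇒0<q-p ρ<1

        c : ℚ
        c = inv 1-ρ>0 * (K * ρ)

        c>0 : 0ℚ < c
        c>0 = *-pos (inv-pos 1-ρ>0) (*-pos K>0 ρ>0)

        rescale : ∀ n k → r ^ n * (K * ρ ^ suc k) ≡ c * r ^ n * (1ℚ - ρ) * ρ ^ k
        rescale n k = trans
          (solve 4 (λ R K ρ p → R :* (K :* (ρ :* p)) := (K :* ρ) :* R :* p) refl
            (r ^ n) K ρ (ρ ^ k))
          (trans (cong (λ u → u * r ^ n * ρ ^ k) (sym (*-inv-cancel 1-ρ>0 (K * ρ))))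
          (solve 4 (λ h c R p → h :* c :* R :* p := c :* R :* h :* p) refl
            (1ℚ - ρ) c (r ^ n) (ρ ^ k)))
          where open +-*-Solver

        partial≺ : ∀ n m → Σ< (suc m) (term (shift n)) ⊖ 1ᶜ ≺ (c + c) * r ^ n
        partial≺ n m = ≺-resp-≈
          (≈-trans (C.solve 1 (λ s → s C.:= ((C.con 0ℚ C.:+ C.con 1ℚ) C.:+ s) C.:- C.con 1ℚ) ≈-refl
              (Σ< m (λ k → term (shift n) (suc k))))
            (+ᶜ-cong (≈-trans (+ᶜ-cong (+ᶜ-cong ≈-refl (≈-sym (term-zero (shift n)))) ≈-refl)
              (≈-sym (Σ<-++ 1 m (term (shift n))))) ≈-refl))
          (subst (Σ< m (λ k → term (shift n) (suc k)) ≺_) (sym (ℚₚ.*-distribʳ-+ (r ^ n) c c))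
            (Σ<-geometric ρ>0 (*-pos c>0 (^-pos r>0 n)) m λ k _ →
              subst (term (shift n) (suc k) ≺_) (rescale n k) (term-suc≺ n k)))
          where module C = ℂ-Solver

        φ≺ : ∀ n → φ (shift≺1 n) ⊖ 1ᶜ ≺ (c + c + 1ℚ) * r ^ n
        -- The empty partial sum lacks the constant term, so the partial sums are taken from length
        -- 1 on.
        φ≺ n = ⇝-limit-≺ (⇝-+ (⇝-suc (proj₂ (series (shift≺1 n)))) (⇝-neg (⇝-const 1ᶜ)))
          (0 , λ m _ → partial≺ n m) (*-monoʳ-< (^-pos r>0 n) (p<p+1 (c + c)))

      φ⇝1 : (λ n → φ (shift≺1 n)) ⇝ 1ᶜ
      φ⇝1 =
        let ρ , ρ>0 , ρ<1 , z≺ρ = ≺-open z≺1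
            geometric {K} K>0 h = term-geometric z≺ρ
            open Tail ρ>0 ρ<1 K>0 h
        in vanishing (+-pos (+-pos c>0 c>0) 0<1) r>0 r<1 φ≺

    q-binomial-theorem : ∀ {z P Q} (z≺1 : z ≺ 1ℚ) →
      qPochhammer z q ⇝ P → qPochhammer (α *ᶜ z) q ⇝ Q → P *ᶜ φ z≺1 ≈ Q
    q-binomial-theorem {z} {P} {Q} z≺1 ⇝P ⇝Q = ≈-trans
      (⇝-unique (⇝-* ⇝P (⇝-const (φ z≺1)))
        (⇝-cong (λ n → ≈-sym (iterated n)) ≈-refl (⇝-* ⇝Q φ⇝1)))
      (solve 1 (λ x → x :* con 1ℚ := x) ≈-refl Q)
      where
      open Iterate z z≺1
      open ℂ-Solver

-- The Cauchy product and the generating function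

module CauchyProduct (s t : ℕ → ℂ) where

  convolution : ℕ → ℂ
  convolution m = Σ< (suc m) λ k → s k *ᶜ t (m ∸ k)

  -- Both sides sum s k t j over the triangle k + j < n, by diagonals on the left and by columns on
  -- the right. From n to n + 1 each column gains its entry on the new diagonal; column n was empty
  -- before.
  Σ<-convolution : ∀ n → Σ< n convolution ≈ Σ< n (λ k → s k *ᶜ Σ< (n ∸ k) t)
  Σ<-convolution zero    = ≈-refl
  Σ<-convolution (suc n) = ≈-sym (≈-trans (Σ<-cong (suc n) split)
    (≈-trans (Σ<-+ (suc n) (λ k → s k *ᶜ Σ< (n ∸ k) t) (λ k → s k *ᶜ t (n ∸ k)))
      (+ᶜ-cong (≈-trans (+ᶜ-cong (≈-sym (Σ<-convolution n)) last≈0)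
        (solve 1 (λ x → x :+ con 0ℚ := x) ≈-refl (Σ< n convolution))) ≈-refl)))
    where
    open ℂ-Solver
    split : ∀ k → k ℕ.< suc n →
            s k *ᶜ Σ< (suc n ∸ k) t ≈ s k *ᶜ Σ< (n ∸ k) t +ᶜ s k *ᶜ t (n ∸ k)
    split k (ℕ.s≤s k≤n) rewrite ℕₚ.+-∸-assoc 1 k≤n =
      solve 3 (λ a b c → a :* (b :+ c) := a :* b :+ a :* c) ≈-refl
        (s k) (Σ< (n ∸ k) t) (t (n ∸ k))
    last≈0 : s n *ᶜ Σ< (n ∸ n) t ≈ 0ᶜ
    last≈0 rewrite ℕₚ.n∸n≡0 n = solve 1 (λ a → a :* con 0ℚ := con 0ℚ) ≈-refl (s n)

  module _ {σ τ : ℚ} (σ>0 : 0ℚ < σ) (σ<τ : σ < τ) (τ<1 : τ < 1ℚ) where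
    private
      τ>0 : 0ℚ < τ
      τ>0 = ℚₚ.<-trans σ>0 σ<τ

      -- The quotient σ/τ of the two rates: σ^k τ^(n-k) = τ^n θ^k, and σ < τ makes θ < 1.
      θ : ℚ
      θ = inv τ>0 * σ

      θ>0 : 0ℚ < θ
      θ>0 = *-pos (inv-pos τ>0) σ>0

      θ<1 : θ < 1ℚ
      θ<1 = subst (θ <_) (trans (ℚₚ.*-comm (inv τ>0) τ) (*-inv τ>0)) (*-monoˡ-< (inv-pos τ>0) σ<τ)

      σ^k*τ^j : ∀ k j → σ ^ k * τ ^ j ≡ τ ^ (k ℕ.+ j) * θ ^ k
      σ^k*τ^j zero    j = ℚₚ.*-comm 1ℚ (τ ^ j)
      σ^k*τ^j (suc k) j = trans (ℚₚ.*-assoc σ (σ ^ k) (τ ^ j))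
        (trans (cong₂ _*_ (sym (*-inv-cancel τ>0 σ)) (σ^k*τ^j k j))
          (solve 4 (λ τ θ p q → τ :* θ :* (p :* q) := τ :* p :* (θ :* q)) refl
            τ θ (τ ^ (k ℕ.+ j)) (θ ^ k)))
        where open +-*-Solver

    -- As s decays faster than the remainders R of Σ t, the errors s k * R (n - k) are
    -- geometric in k, with a sum of order τ ^ n.
    remainder⇝0 : ∀ {R} → Geometric s σ → Geometric R τ →
                  (λ n → Σ< n λ k → negᶜ (s k *ᶜ R (n ∸ k))) ⇝ 0ᶜ
    remainder⇝0 {R} (geometric {K} K>0 s≺) (geometric {L} L>0 R≺) =
      vanishing (+-pos c>0 c>0) τ>0 τ<1 λ n →
        ≺-resp-≈ (C.solve 1 (λ x → x C.:= x C.:- C.con 0ℚ) ≈-refl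
            (Σ< n λ k → negᶜ (s k *ᶜ R (n ∸ k))))
          (subst ((Σ< n λ k → negᶜ (s k *ᶜ R (n ∸ k))) ≺_) (sym (ℚₚ.*-distribʳ-+ (τ ^ n) c c))
            (Σ<-geometric θ>0 (*-pos c>0 (^-pos τ>0 n)) n λ k k<n →
              subst (negᶜ (s k *ᶜ R (n ∸ k)) ≺_) (rescale n k (ℕₚ.<⇒≤ k<n))
                (≺-neg (≺-* (s≺ k) (R≺ (n ∸ k))))))
      where
      module C = ℂ-Solver
      open +-*-Solver
      1-θ>0 = p<q⇒0<q-p θ<1
      c = inv 1-θ>0 * (K * L)
      c>0 : 0ℚ < c
      c>0 = *-pos (inv-pos 1-θ>0) (*-pos K>0 L>0)
      rescale : ∀ n k → k ℕ.≤ n →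
                (K * σ ^ k) * (L * τ ^ (n ∸ k)) ≡ c * τ ^ n * (1ℚ - θ) * θ ^ k
      rescale n k k≤n = trans
        (solve 4 (λ K p L q → (K :* p) :* (L :* q) := K :* L :* (p :* q)) refl
          K (σ ^ k) L (τ ^ (n ∸ k)))
        (trans (cong₂ _*_ (sym (*-inv-cancel 1-θ>0 (K * L)))
            (trans (σ^k*τ^j k (n ∸ k)) (cong (λ m → τ ^ m * θ ^ k) (ℕₚ.m+[n∸m]≡n k≤n))))
          (solve 4 (λ h c p q → h :* c :* (p :* q) := c :* p :* h :* q) refl
            (1ℚ - θ) c (τ ^ n) (θ ^ k)))

    -- As in Mertens' theorem, the partial sum of the convolution equals (Σ s k) T minus Σ s k R (n
    -- - k), with R the remainders of Σ t, so only the last sum has to tend to 0.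
    cauchy-product : ∀ {S T} → Geometric s σ → Geometric t τ →
      (λ n → Σ< n s) ⇝ S → (λ n → Σ< n t) ⇝ T → (λ n → Σ< n convolution) ⇝ S *ᶜ T
    cauchy-product {S} {T} s-geo t-geo ⇝S ⇝T =
      -- The remainder bound refers to its own limit T′ of Σ t; uniqueness of limits identifies it
      -- with T.
      let mkSum T′ ⇝T′ R-geo = geometric-sum τ>0 τ<1 t-geo in
      ⇝-cong (λ n → ≈-sym (decompose T′ n))
        (≈-trans (solve 1 (λ x → x :+ con 0ℚ := x) ≈-refl (S *ᶜ T′))
          (*ᶜ-cong ≈-refl (⇝-unique ⇝T′ ⇝T)))
        (⇝-+ (⇝-* ⇝S (⇝-const T′)) (remainder⇝0 s-geo R-geo))
      where
      open ℂ-Solver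
      decompose : ∀ T′ n → Σ< n convolution ≈
        Σ< n s *ᶜ T′ +ᶜ Σ< n (λ k → negᶜ (s k *ᶜ (T′ ⊖ Σ< (n ∸ k) t)))
      decompose T′ n = ≈-trans (Σ<-convolution n)
        (≈-trans (Σ<-cong n λ k _ →
            solve 3 (λ a b u → a :* b := a :* u :+ (:- (a :* (u :- b)))) ≈-refl
              (s k) (Σ< (n ∸ k) t) T′)
        (≈-trans (Σ<-+ n (λ k → s k *ᶜ T′) (λ k → negᶜ (s k *ᶜ (T′ ⊖ Σ< (n ∸ k) t))))
          (+ᶜ-cong (Σ<-*ʳ n s T′) ≈-refl)))

qPochhammer-cong : ∀ {a b} q → a ≈ b → ∀ n → qPochhammer a q n ≈ qPochhammer b q n
qPochhammer-cong         q a≈b zero    = ≈-refl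
qPochhammer-cong {a} {b} q a≈b (suc n) = *ᶜ-cong (qPochhammer-cong q a≈b n)
  (≈-trans (-ᶜ≈⊖ 1ᶜ (q ^ᶜ n *ᶜ a)) (≈-trans
    (+ᶜ-cong ≈-refl (negᶜ-cong (*ᶜ-cong ≈-refl a≈b))) (≈-sym (-ᶜ≈⊖ 1ᶜ (q ^ᶜ n *ᶜ b)))))

qPochhammer-0 : ∀ q n → qPochhammer 0ᶜ q n ≈ 1ᶜ
qPochhammer-0 q zero    = ≈-refl
qPochhammer-0 q (suc n) = ≈-trans (*ᶜ-cong (qPochhammer-0 q n) (-ᶜ≈⊖ 1ᶜ (q ^ᶜ n *ᶜ 0ᶜ)))
  (solve 1 (λ p → con 1ℚ :* (con 1ℚ :- p :* con 0ℚ) := con 1ℚ) ≈-refl (q ^ᶜ n))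
  where open ℂ-Solver

^ᶜ-+ : ∀ z m n → z ^ᶜ (m ℕ.+ n) ≈ z ^ᶜ m *ᶜ z ^ᶜ n
^ᶜ-+ z zero    n = ≈-sym (*ᶜ-identityˡ (z ^ᶜ n))
^ᶜ-+ z (suc m) n = ≈-trans (*ᶜ-cong ≈-refl (^ᶜ-+ z m n)) (≈-sym (*ᶜ-assoc z (z ^ᶜ m) (z ^ᶜ n)))

module GeneratingFunction (q : ℂ) (r : ℚ) (r>0 : 0ℚ < r) (r<1 : r < 1ℚ) (q≺r : q ≺ r) where
  open QSeries q r r>0 r<1 q≺r

  q-exponential : ∀ {z P} (z≺1 : z ≺ 1ℚ) → qPochhammer z q ⇝ P → P *ᶜ Heine.φ 0ᶜ z≺1 ≈ 1ᶜ
  q-exponential {z} z≺1 ⇝P = Heine.q-binomial-theorem 0ᶜ z≺1 ⇝P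
    (⇝-cong (λ n → ≈-sym (≈-trans (qPochhammer-cong q 0z≈0 n) (qPochhammer-0 q n))) ≈-refl
      (⇝-const 1ᶜ))
    where
    open ℂ-Solver
    0z≈0 : 0ᶜ *ᶜ z ≈ 0ᶜ
    0z≈0 = solve 1 (λ z → con 0ℚ :* z := con 0ℚ) ≈-refl z

  invPochhammer-* : ∀ k j nz →
    invᶜ (qPochhammer q q k *ᶜ qPochhammer q q j) nz ≈ invPochhammer k *ᶜ invPochhammer j
  invPochhammer-* k j nz = inverse-unique (*ᶜ-inverseʳ (qPochhammer q q k *ᶜ qPochhammer q q j) nz)
    (≈-trans (solve 4 (λ p s u v → p :* s :* (u :* v) := (p :* u) :* (s :* v)) ≈-refl
        (qPochhammer q q k) (qPochhammer q q j) (invPochhammer k) (invPochhammer j))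
      (≈-trans (*ᶜ-cong (*ᶜ-inverseʳ (qPochhammer q q k) (q≠ k))
                        (*ᶜ-inverseʳ (qPochhammer q q j) (q≠ j))) (*ᶜ-identityˡ 1ᶜ)))
    where open ℂ-Solver

  -- The (q;q)_m of the q-binomial coefficient cancels the division by (q;q)_m, and y^m = y^k
  -- y^(m-k) completes b^k and x^(m-k) to powers of by and xy.
  hahn-term : ∀ α b x y m →
    hahn q q≠ m α b x *ᶜ (y ^ᶜ m /ᶜ qPochhammer q q m ⟨ q≠ m ⟩)
      ≈ CauchyProduct.convolution (Heine.term α (b *ᶜ y)) (Heine.term 0ᶜ (x *ᶜ y)) m
  hahn-term α b x y m = ≈-trans
    (≈-sym (Σ<-*ʳ (suc m) _ (y ^ᶜ m *ᶜ invPochhammer m)))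
    (Σ<-cong (suc m) λ { k (ℕ.s≤s k≤m) → summand k k≤m })
    where
    open ℂ-Solver
    summand : ∀ k → k ℕ.≤ m →
      qBinomial q q≠ m k *ᶜ qPochhammer α q k *ᶜ b ^ᶜ k *ᶜ x ^ᶜ (m ∸ k)
        *ᶜ (y ^ᶜ m *ᶜ invPochhammer m)
      ≈ Heine.term α (b *ᶜ y) k *ᶜ Heine.term 0ᶜ (x *ᶜ y) (m ∸ k)
    summand k k≤m =
      ≈-trans (*ᶜ-cong
        (*ᶜ-cong (*ᶜ-cong (*ᶜ-cong (*ᶜ-cong ≈-refl (invPochhammer-* k j _)) ≈-refl) ≈-refl) ≈-refl)
        (*ᶜ-cong y^m≈ ≈-refl))
      -- The factor `con 1ℚ` is a placeholder for (0;q)_j, the numerator in `Heine.term 0ᶜ`.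
      (≈-trans (solve 9 (λ P u v A bk xj yk yj I →
          P :* (u :* v) :* A :* bk :* xj :* ((yk :* yj) :* I)
            := (P :* I) :* (A :* (bk :* yk) :* u :* (con 1ℚ :* (xj :* yj) :* v))) ≈-refl
          (qPochhammer q q m) (invPochhammer k) (invPochhammer j) (qPochhammer α q k)
          (b ^ᶜ k) (x ^ᶜ j) (y ^ᶜ k) (y ^ᶜ j) (invPochhammer m))
      (≈-trans (*ᶜ-cong (*ᶜ-inverseʳ (qPochhammer q q m) (q≠ m)) (*ᶜ-cong
          (*ᶜ-cong (*ᶜ-cong ≈-refl (≈-sym (^ᶜ-distrib-* b y k))) ≈-refl)
          (*ᶜ-cong (*ᶜ-cong (≈-sym (qPochhammer-0 q j)) (≈-sym (^ᶜ-distrib-* x y j))) ≈-refl)))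
        (*ᶜ-identityˡ _)))
      where
      j = m ∸ k
      y^m≈ : y ^ᶜ m ≈ y ^ᶜ k *ᶜ y ^ᶜ j
      y^m≈ = subst (λ i → y ^ᶜ i ≈ y ^ᶜ k *ᶜ y ^ᶜ j) (ℕₚ.m+[n∸m]≡n k≤m) (^ᶜ-+ y k j)

  hahn-sum : ∀ α b x y (xy≺1 : x *ᶜ y ≺ 1ℚ) (by≺1 : b *ᶜ y ≺ 1ℚ) →
    (λ n → Σ< n λ m → hahn q q≠ m α b x *ᶜ (y ^ᶜ m /ᶜ qPochhammer q q m ⟨ q≠ m ⟩))
      ⇝ Heine.φ α by≺1 *ᶜ Heine.φ 0ᶜ xy≺1
  hahn-sum α b x y xy≺1 by≺1 =
    let σ , σ>0 , σ<1 , by≺σ = ≺-open by≺1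
        ξ , ξ>0 , ξ<1 , xy≺ξ = ≺-open xy≺1
        -- `cauchy-product` wants the first rate strictly below the second, so the bound on xy is
        -- relaxed to a τ above both radii.
        τ , m<τ , τ<1 = ℚₚ.<-dense (⊔<1 σ<1 ξ<1)
        σ<τ = ℚₚ.≤-<-trans (ℚₚ.p≤p⊔q σ ξ) m<τ
        ξ<τ = ℚₚ.≤-<-trans (ℚₚ.p≤q⊔p σ ξ) m<τ
    in ⇝-cong (λ n → Σ<-cong n λ m _ → ≈-sym (hahn-term α b x y m)) ≈-refl
      (CauchyProduct.cauchy-product (Heine.term α (b *ᶜ y)) (Heine.term 0ᶜ (x *ᶜ y)) σ>0 σ<τ τ<1
        (Heine.term-geometric α by≺σ)
        (Heine.term-geometric 0ᶜ (≺-mono (ℚₚ.<⇒≤ ξ<τ) xy≺ξ))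
        (proj₂ (Heine.series α by≺1)) (proj₂ (Heine.series 0ᶜ xy≺1)))
    where
    ⊔<1 : ∀ {σ ξ} → σ < 1ℚ → ξ < 1ℚ → σ ℚ.⊔ ξ < 1ℚ
    ⊔<1 {σ} {ξ} σ<1 ξ<1 with ℚₚ.⊔-sel σ ξ
    ... | inj₁ eq = subst (_< 1ℚ) (sym eq) σ<1
    ... | inj₂ eq = subst (_< 1ℚ) (sym eq) ξ<1

-- Multiply uv by 1 = (BC)w and regroup as (Bv)((Cu)w).
quotient≈ : ∀ {A B C u v w} → C *ᶜ u ≈ A → B *ᶜ v ≈ 1ᶜ → (B *ᶜ C) *ᶜ w ≈ 1ᶜ → u *ᶜ v ≈ A *ᶜ w
quotient≈ {A} {B} {C} {u} {v} {w} Cu≈A Bv≈1 BCw≈1 =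
  ≈-trans (≈-sym (*ᶜ-identityˡ (u *ᶜ v)))
  (≈-trans (*ᶜ-cong (≈-sym BCw≈1) ≈-refl)
  (≈-trans (solve 5 (λ B C u v w → B :* C :* w :* (u :* v) := (B :* v) :* ((C :* u) :* w)) ≈-refl
    B C u v w)
  (≈-trans (*ᶜ-cong Bv≈1 (*ᶜ-cong Cu≈A ≈-refl)) (*ᶜ-identityˡ (A *ᶜ w)))))
  where open ℂ-Solver

-- Apartness of each (q;q)_m and of BC from 0, and convergence of the three products, belong to the
-- conclusion: the summands and the quotient cannot be written down without these witnesses.
theorem8 : (q : ℂ) (n : ℕ) (b x y : ℂ) →
    ∣ q ∣ᶜ <ᴿ 1ᴿ → ∣ x *ᶜ y ∣ᶜ <ᴿ 1ᴿ → ∣ b *ᶜ y ∣ᶜ <ᴿ 1ᴿ →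
    Σ[ q≠ ∈ (∀ m → NonZeroᶜ (qPochhammer q q m)) ]
    Σ[ A ∈ ℂ ] Σ[ B ∈ ℂ ] Σ[ C ∈ ℂ ]
      IsQPochhammer∞ (q ^ᶜ n *ᶜ b *ᶜ y) q A ×
      IsQPochhammer∞ (x *ᶜ y) q B ×
      IsQPochhammer∞ (b *ᶜ y) q C ×
      (Σ[ BC≠ ∈ NonZeroᶜ (B *ᶜ C) ]
        HasSum (λ m → hahn q q≠ m (q ^ᶜ n) b x *ᶜ (y ^ᶜ m /ᶜ qPochhammer q q m ⟨ q≠ m ⟩))
               (A /ᶜ (B *ᶜ C) ⟨ BC≠ ⟩))
theorem8 q n b x y ∣q∣<1 ∣xy∣<1 ∣by∣<1 =
  let xy≺1 = <1⇒≺1 ∣xy∣<1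
      by≺1 = <1⇒≺1 ∣by∣<1
      r , r>0 , r<1 , q≺r = ≺-open (<1⇒≺1 ∣q∣<1)
      open QSeries q r r>0 r<1 q≺r
      open GeneratingFunction q r r>0 r<1 q≺r
      A , ⇝A = qPochhammer-converges (q ^ᶜ n *ᶜ b *ᶜ y)
      B , ⇝B = qPochhammer-converges (x *ᶜ y)
      C , ⇝C = qPochhammer-converges (b *ᶜ y)
      B*e≈1 = q-exponential xy≺1 ⇝B
      C*e≈1 = q-exponential by≺1 ⇝C
      C*φ≈A = Heine.q-binomial-theorem (q ^ᶜ n) by≺1 ⇝C
        -- (q^n b) y is reassociated to q^n (by), the form αz of the q-binomial theorem.
        (⇝-cong (qPochhammer-cong q (*ᶜ-assoc (q ^ᶜ n) b y)) ≈-refl ⇝A)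
      -- e(xy) e(by) is an inverse of BC.
      BC≠ = unit⇒nonZero (≈-trans (interchange B C _ _)
        (≈-trans (*ᶜ-cong B*e≈1 C*e≈1) (*ᶜ-identityˡ 1ᶜ)))
  in q≠ , A , B , C , ⇝⇒⟶ ⇝A , ⇝⇒⟶ ⇝B , ⇝⇒⟶ ⇝C , BC≠ ,
    ⇝⇒⟶ (⇝-cong (λ _ → ≈-refl) (quotient≈ C*φ≈A B*e≈1 (*ᶜ-inverseʳ (B *ᶜ C) BC≠))
      (hahn-sum (q ^ᶜ n) b x y xy≺1 by≺1))
  where
  open ℂ-Solver
  interchange : ∀ B C u v → (B *ᶜ C) *ᶜ (u *ᶜ v) ≈ (B *ᶜ u) *ᶜ (C *ᶜ v)
  interchange = solve 4 (λ B C u v → (B :* C) :* (u :* v) := (B :* u) :* (C :* v)) ≈-refl
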